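{- Let $\Sigma=(B,\sigma)$ be a signed graph whose underlying graph $B$ is a block that is neither a single edge nor a circle, and suppose $[e,C,+]$ is a positive battery. If $C$ has at least three bridges, then no edge of $B$ outside $C$ is a positive battery (i.e. every edge not in $C$ lies in either zero or at least two positive circles).
   Context: A signed graph $\Sigma=(G,\sigma)$ is a finite graph $G$ with signature $\sigma:E(G)\to\{+,-\}$. A circle is a connected 2-regular subgraph; its sign is the product of its edge signs. A block is a maximal subgraph without a cutpoint. For a circle $C$, a chord is an edge not in $C$ joining two distinct vertices of $C$; a bridge of $C$ is either a chord or a connected component $D$ of $G\setminus V(C)$ together with all edges joining $D$ to $C$. An edge $f$ is a positive battery if it lies in exactly one positive circle; $[e,C,+]$ means $C$ is a positive circle containing $e$ and is the only positive circle containing $e$. -}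

module Defs where

open import Algebra.Properties.CommutativeMonoid.Sum using (sum)
open import Data.Bool.Base using (if_then_else_; _∧_; _∨_)
open import Data.Fin.Base using (Fin)
open import Data.Fin.Properties using (_≟_)
open import Data.Fin.Subset
  using (Subset; _∈_; _∉_; _⊆_; _∪_; _∩_; ∁; ⊥; ⊤; ⁅_⁆; Nonempty)
open import Data.Nat.Base using (ℕ; _+_)
open import Data.Nat.Properties using (+-0-commutativeMonoid)
open import Data.Product.Base using (∃; ∃₂; _×_)
open import Data.Sign.Base as Sign using (Sign)
open import Data.Sign.Properties using (*-commutativeMonoid)
open import Data.Sum.Base using (_⊎_)
open import Data.Vec.Base using (lookup; tabulate)
open import Function.Definitions using (Injective)
open import Relation.Binary.Construct.Closure.ReflexiveTransitive using (Star)
open import Relation.Binary.PropositionalEquality.Core using (_≡_; _≢_)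
open import Relation.Nullary.Decidable.Core using (does)
open import Relation.Nullary.Negation.Core using (¬_)

-- Loops and parallel edges are allowed.  The order of the two ends of an
-- edge carries no meaning: everything below is symmetric in end₁ and end₂.
record Graph : Set where
  field
    order : ℕ
    size  : ℕ
    end₁  : Fin size → Fin order
    end₂  : Fin size → Fin order

open Graph public

record SignedGraph : Set where
  field
    graph : Graph
    σ     : Fin (size graph) → Sign

open SignedGraph public

-- A set of vertices with a set of edges.  That the edges have their ends
-- among the vertices is the separate predicate IsSubgraph, so that
-- propositional equality of pieces is equality of the two sets.
record Piece (G : Graph) : Set where
  constructor piece
  field
    verts : Subset (order G)
    edges : Subset (size G)

open Piece public

whole : (G : Graph) → Piece G
whole G = piece ⊤ ⊤

infix 4 _⊑_

_⊑_ : {G : Graph} → Piece G → Piece G → Set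
H ⊑ K = verts H ⊆ verts K × edges H ⊆ edges K

IsSubgraph : {G : Graph} → Piece G → Set
IsSubgraph {G} H = ∀ e → e ∈ edges H → end₁ G e ∈ verts H × end₂ G e ∈ verts H

Joins : (G : Graph) → Fin (size G) → Fin (order G) → Fin (order G) → Set
Joins G e u v = (end₁ G e ≡ u × end₂ G e ≡ v) ⊎ (end₁ G e ≡ v × end₂ G e ≡ u)

Adjacent : {G : Graph} → Piece G → Fin (order G) → Fin (order G) → Set
Adjacent {G} H u v = ∃ λ e → e ∈ edges H × Joins G e u v

Connected : {G : Graph} → Piece G → Set
Connected H =
  Nonempty (verts H) ×
  (∀ u v → u ∈ verts H → v ∈ verts H → Star (Adjacent H) u v)

-- A loop contributes 2 to the degree of its vertex.
degree : {G : Graph} → Piece G → Fin (order G) → ℕ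
degree {G} H v = sum +-0-commutativeMonoid λ e →
  if lookup (edges H) e
  then (if does (end₁ G e ≟ v) then 1 else 0) + (if does (end₂ G e ≟ v) then 1 else 0)
  else 0

IsCircle : {G : Graph} → Piece G → Set
IsCircle H = IsSubgraph H × Connected H × (∀ v → v ∈ verts H → degree H v ≡ 2)

IsSingleEdge : {G : Graph} → Piece G → Set
IsSingleEdge {G} H = ∃ λ e →
  edges H ≡ ⁅ e ⁆ × verts H ≡ ⁅ end₁ G e ⁆ ∪ ⁅ end₂ G e ⁆

-- H is the union of two subgraphs, each having an edge, that share the
-- vertex v and nothing else.  In particular a vertex that supports a loop
-- and is incident with another edge of H is a cutpoint.  The notion is only
-- applied to connected H, where K and L are then automatically connected;
-- for connected loopless H it says that deleting v disconnects H.
IsCutpoint : {G : Graph} → Piece G → Fin (order G) → Set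
IsCutpoint {G} H v = ∃₂ λ (K L : Piece G) →
  IsSubgraph K × IsSubgraph L ×
  Nonempty (edges K) × Nonempty (edges L) ×
  verts K ∪ verts L ≡ verts H × edges K ∪ edges L ≡ edges H ×
  verts K ∩ verts L ≡ ⁅ v ⁆ × edges K ∩ edges L ≡ ⊥

IsNonseparable : {G : Graph} → Piece G → Set
IsNonseparable H = IsSubgraph H × Connected H × ¬ (∃ λ v → IsCutpoint H v)

IsBlock : {G : Graph} → Piece G → Set
IsBlock H = IsNonseparable H × (∀ K → IsNonseparable K → H ⊑ K → K ≡ H)

-- The graph G ∖ X obtained by deleting the vertices in X together with all
-- edges having an end in X.
delete : (G : Graph) → Subset (order G) → Piece G
delete G X = piece (∁ X) (tabulate λ e →
  lookup (∁ X) (end₁ G e) ∧ lookup (∁ X) (end₂ G e))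

IsComponent : {G : Graph} → Piece G → Piece G → Set
IsComponent {G} H D =
  IsSubgraph D × D ⊑ H × Connected D ×
  (∀ (K : Piece G) → IsSubgraph K → K ⊑ H → Connected K → D ⊑ K → K ≡ D)

edgesBetween : (G : Graph) → Subset (order G) → Subset (order G) → Subset (size G)
edgesBetween G X Y = tabulate λ e →
  (lookup X (end₁ G e) ∧ lookup Y (end₂ G e)) ∨
  (lookup Y (end₁ G e) ∧ lookup X (end₂ G e))

IsChord : {G : Graph} → Piece G → Fin (size G) → Set
IsChord {G} C f =
  f ∉ edges C × end₁ G f ∈ verts C × end₂ G f ∈ verts C × end₁ G f ≢ end₂ G f

-- A bridge of C is recorded as its edges together with its vertices outside
-- C.  The vertices of C at which it attaches are determined by the edges.
data IsBridge {G : Graph} (C : Piece G) : Piece G → Set where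
  chord     : ∀ f → IsChord C f → IsBridge C (piece ⊥ ⁅ f ⁆)
  component : ∀ D → IsComponent (delete G (verts C)) D →
              IsBridge C (piece (verts D) (edges D ∪ edgesBetween G (verts D) (verts C)))

HasAtLeastBridges : {G : Graph} → ℕ → Piece G → Set
HasAtLeastBridges {G} k C = ∃ λ (b : Fin k → Piece G) →
  Injective _≡_ _≡_ b × (∀ i → IsBridge C (b i))

sign : (S : SignedGraph) → Piece (graph S) → Sign
sign S H = sum *-commutativeMonoid λ e →
  if lookup (edges H) e then σ S e else Sign.+

IsPositiveCircle : (S : SignedGraph) → Piece (graph S) → Set
IsPositiveCircle S C = IsCircle C × sign S C ≡ Sign.+

-- The relation [e, C, +].
OnlyPositiveCircle : (S : SignedGraph) → Fin (size (graph S)) → Piece (graph S) → Set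
OnlyPositiveCircle S e C =
  IsPositiveCircle S C × e ∈ edges C ×
  (∀ C′ → IsPositiveCircle S C′ → e ∈ edges C′ → C′ ≡ C)

IsPositiveBattery : (S : SignedGraph) → Fin (size (graph S)) → Set
IsPositiveBattery S e = ∃ λ C → OnlyPositiveCircle S e C

{-# OPTIONS --safe #-}
-- Any path P that leaves C at a and returns at b ≠ a (an ear) closes up along the arc of C
-- through e to a circle through e other than C, hence negative.  After switching C to be all
-- positive, every ear is therefore negative.  Two ears that are disjoint off C can always be
-- joined by two disjoint arcs of C, and the resulting circle is positive.  Because B is a block,
-- every edge outside C lies on an ear, and ears in different bridges are disjoint off C.  If f is
-- outside C, at least two of three bridges do not contain f, so an ear through f can be joined
-- to an ear in each of them; this gives two positive circles through f.
module Submission where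

open import Defs
open import Algebra.Bundles using (CommutativeMonoid)
open import Data.Bool.Base using (true; false; if_then_else_; _∧_; _∨_)
open import Data.Bool.Properties using (∨-zeroʳ)
open import Data.Empty using (⊥-elim)
open import Data.Fin.Base using (Fin; zero; suc)
open import Data.Fin.Properties using (_≟_; injective⇒≤)
open import Data.Fin.Subset
  using (Subset; _∈_; _∉_; _⊆_; _∪_; _∩_; ∁; ⊥; ⊤; ⁅_⁆; Nonempty; inside; outside)
open import Data.Fin.Subset.Properties
open import Data.List.Base as List using (List; []; _∷_; foldr; length)
open import Data.List.Membership.Propositional using () renaming (_∈_ to _∈ˡ_; _∉_ to _∉ˡ_)
open import Data.List.Membership.Propositional.Properties using (∈-lookup)
open import Data.List.Relation.Unary.All as All using ([]; _∷_)
open import Data.List.Relation.Unary.AllPairs using ([]; _∷_)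
open import Data.List.Relation.Unary.Any using (here; there)
open import Data.List.Relation.Unary.Unique.Propositional using (Unique)
open import Data.Nat.Base using (ℕ; zero; suc; _+_; _≤_; z≤n; s≤s)
open import Data.Nat.Properties
  using (+-0-commutativeMonoid; +-comm; +-identityʳ; +-suc; +-monoˡ-≤; m≤m+n; m≤n+m; m+[n∸m]≡n;
         ≤-trans; ≤-reflexive; 1+n≰n)
open import Data.Nat.Tactic.RingSolver using (solve-∀)
open import Data.Product.Base using (∃; ∃₂; _×_; _,_; proj₁; proj₂)
open import Data.Sign.Base as Sign using (Sign; opposite; _*_)
open import Data.Sign.Properties using (*-commutativeMonoid; *-assoc; *-comm; *-identityʳ; s*s≡+)
open import Data.Sum.Base as Sum using (_⊎_; inj₁; inj₂; [_,_]; [_,_]′)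
open import Data.Vec.Base using (lookup; tabulate; []; _∷_; here; there; _[_]≔_)
open import Data.Vec.Properties using (lookup⇒[]=; []=⇒lookup; lookup∘tabulate)
open import Function.Base using (_∘_; id)
open import Level using (0ℓ)
open import Relation.Binary.Construct.Closure.ReflexiveTransitive as Star using (Star; ε; _◅_; _◅◅_)
open import Relation.Binary.PropositionalEquality.Core
  using (_≡_; _≢_; refl; sym; trans; cong; cong₂; subst)
open import Relation.Nullary.Decidable
  using (Dec; yes; no; does; dec-true; dec-false; decidable-stable; ¬¬-excluded-middle; _⊎-dec_)
open import Relation.Nullary.Negation.Core using (¬_; contradiction)
open import Relation.Unary using (Decidable)

-- The goal is a negation, so existence of ears and linkage of edges may be used classically under
-- double negation; neither is ever decided.
--
-- Why a block leaves no edge `g` outside `C` without an ear: collect the edges reached from `g`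
-- through vertices that lie neither on `C` nor on any ear. This class can meet the remaining edges
-- only at vertices of `C` or of ears. Two such vertices would be joined by a path within the class;
-- disjoint routes along ears would continue that path to `C` and produce an ear through the class.
-- So there is only one, a cutpoint. The disjoint routes come from rerouting one walk along an ear,
-- not from a general Menger argument.
--
-- The graph itself is never switched: a potential `τ` on the vertices records the switching, and
-- its values cancel in pairs around a circle.
--
-- Bridges enter only through linkage of edges at vertices off `C`: edges of one ear are linked, and
-- edges of different bridges are not. This is also what makes the two final circles differ.

-- Finite subsets and lists.

-- Excluded middle is needed once per index, and finitely many uses fit under one double negation.
-- With `zero` the value `outside` is offered first; a proof of `P zero` then calls `k` again with
-- `inside`.
comprehension : ∀ {n} (P : Fin n → Set) →
  ¬ ¬ (∃ λ (S : Subset n) → ∀ i → (i ∈ S → P i) × (P i → i ∈ S))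
comprehension {zero}  P k = k ([] , λ ())
comprehension {suc n} P k = comprehension (P ∘ suc) λ (S , spec) →
  k (outside ∷ S , λ
    { zero    → (λ ()) , λ p → ⊥-elim (k (inside ∷ S , λ
        { zero    → (λ _ → p) , (λ _ → here)
        ; (suc i) → (λ { (there q) → proj₁ (spec i) q }) , there ∘ proj₂ (spec i) }))
    ; (suc i) → (λ { (there q) → proj₁ (spec i) q }) , there ∘ proj₂ (spec i) })

∈-tabulate⁻ : ∀ {n} f {i : Fin n} → i ∈ tabulate f → f i ≡ true
∈-tabulate⁻ f {i} i∈ = trans (sym (lookup∘tabulate f i)) ([]=⇒lookup i∈)

∈-tabulate⁺ : ∀ {n} f {i : Fin n} → f i ≡ true → i ∈ tabulate f
∈-tabulate⁺ f {i} eq = lookup⇒[]= i _ (trans (lookup∘tabulate f i) eq)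

fromList : ∀ {n} → List (Fin n) → Subset n
fromList = foldr (λ i S → ⁅ i ⁆ ∪ S) ⊥

∈-fromList⁺ : ∀ {n} {i : Fin n} {xs} → i ∈ˡ xs → i ∈ fromList xs
∈-fromList⁺ (here refl) = x∈p∪q⁺ (inj₁ (x∈⁅x⁆ _))
∈-fromList⁺ (there i∈)  = x∈p∪q⁺ (inj₂ (∈-fromList⁺ i∈))

∈-fromList⁻ : ∀ {n} {i : Fin n} xs → i ∈ fromList xs → i ∈ˡ xs
∈-fromList⁻ []       i∈ = ⊥-elim (∉⊥ i∈)
∈-fromList⁻ (x ∷ xs) i∈ with x∈p∪q⁻ ⁅ x ⁆ (fromList xs) i∈
... | inj₁ i∈x  = here (x∈⁅y⁆⇒x≡y x i∈x)
... | inj₂ i∈xs = there (∈-fromList⁻ xs i∈xs)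

removeAll : ∀ {n} → Subset n → List (Fin n) → Subset n
removeAll S []       = S
removeAll S (x ∷ xs) = removeAll (S [ x ]≔ outside) xs

∈-erase⁻ : ∀ {n} (S : Subset n) x {i} → i ∈ S [ x ]≔ outside → i ∈ S × i ≢ x
∈-erase⁻ (_ ∷ S) zero    (there i∈) = there i∈ , λ ()
∈-erase⁻ (_ ∷ S) (suc x) here       = here , λ ()
∈-erase⁻ (_ ∷ S) (suc x) (there i∈) with ∈-erase⁻ S x i∈
... | i∈S , i≢x = there i∈S , λ { refl → i≢x refl }

∈-erase⁺ : ∀ {n} (S : Subset n) x {i} → i ∈ S → i ≢ x → i ∈ S [ x ]≔ outside
∈-erase⁺ (_ ∷ S) zero    here       i≢x = contradiction refl i≢x
∈-erase⁺ (_ ∷ S) zero    (there i∈) _   = there i∈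
∈-erase⁺ (_ ∷ S) (suc x) here       _   = here
∈-erase⁺ (_ ∷ S) (suc x) (there i∈) i≢x = there (∈-erase⁺ S x i∈ (i≢x ∘ cong suc))

removeAll⁻ : ∀ {n} (S : Subset n) xs {i} → i ∈ removeAll S xs → i ∈ S × i ∉ˡ xs
removeAll⁻ S []       i∈ = i∈ , λ ()
removeAll⁻ S (x ∷ xs) i∈ with removeAll⁻ (S [ x ]≔ outside) xs i∈
... | i∈S-x , i∉xs with ∈-erase⁻ S x i∈S-x
... | i∈S , i≢x = i∈S , λ { (here i≡x) → i≢x i≡x ; (there i∈xs) → i∉xs i∈xs }

-- Sums over finite subsets in a commutative monoid.

module SubsetSum (M : CommutativeMonoid 0ℓ 0ℓ) where

  open CommutativeMonoid M renaming (ε to 0#; refl to ≈-refl; sym to ≈-sym; trans to ≈-trans)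
  open import Algebra.Properties.CommutativeMonoid.Sum M using (sum)
  open import Algebra.Properties.CommutativeSemigroup commutativeSemigroup using (x∙yz≈y∙xz)

  -- Unfolds to the expression defining `degree` over the naturals and to the one defining `sign`
  -- over signs, so both are covered without conversion.
  ∑∈ : ∀ {n} → (Fin n → Carrier) → Subset n → Carrier
  ∑∈ g S = sum λ i → if lookup S i then g i else 0#

  ∑ˡ : ∀ {n} → (Fin n → Carrier) → List (Fin n) → Carrier
  ∑ˡ g = foldr (λ i s → g i ∙ s) 0#

  ∑∈-extract : ∀ {n} (g : Fin n → Carrier) {S x} → x ∈ S → ∑∈ g S ≈ g x ∙ ∑∈ g (S [ x ]≔ outside)
  ∑∈-extract g {_ ∷ S} here = ∙-congˡ (≈-sym (identityˡ _))
  ∑∈-extract g {true ∷ S} (there x∈) =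
    ≈-trans (∙-congˡ (∑∈-extract (g ∘ suc) x∈)) (x∙yz≈y∙xz _ _ _)
  ∑∈-extract g {false ∷ S} (there x∈) =
    ≈-trans (∙-congˡ (∑∈-extract (g ∘ suc) x∈)) (x∙yz≈y∙xz _ _ _)

  -- The remainder is kept as a summand for two uses: it vanishes for `fromList`, and when nonzero
  -- it reveals an edge that the list misses.
  ∑∈-split : ∀ {n} (g : Fin n → Carrier) S {xs} → Unique xs → (∀ {i} → i ∈ˡ xs → i ∈ S) →
    ∑∈ g S ≈ ∑ˡ g xs ∙ ∑∈ g (removeAll S xs)
  ∑∈-split g S []              xs⊆S = ≈-sym (identityˡ _)
  ∑∈-split g S (_∷_ {x} x∉ xs!) xs⊆S =
    ≈-trans (∑∈-extract g (xs⊆S (here refl)))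
    (≈-trans (∙-congˡ (∑∈-split g (S [ x ]≔ outside) xs! λ i∈ →
        ∈-erase⁺ S x (xs⊆S (there i∈)) λ i≡x → All.lookup x∉ i∈ (sym i≡x)))
    (≈-sym (assoc _ _ _)))

  ∑∈-vanishing : ∀ {n} (g : Fin n → Carrier) S → (∀ i → i ∈ S → g i ≈ 0#) → ∑∈ g S ≈ 0#
  ∑∈-vanishing g []          _    = ≈-refl
  ∑∈-vanishing g (true ∷ S)  zero′ = ≈-trans
    (∙-cong (zero′ zero here) (∑∈-vanishing (g ∘ suc) S λ i → zero′ (suc i) ∘ there)) (identityˡ _)
  ∑∈-vanishing g (false ∷ S) zero′ = ≈-trans
    (∙-congˡ (∑∈-vanishing (g ∘ suc) S λ i → zero′ (suc i) ∘ there)) (identityˡ _)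

  ∑∈-fromList : ∀ {n} (g : Fin n → Carrier) {xs} → Unique xs → ∑∈ g (fromList xs) ≈ ∑ˡ g xs
  ∑∈-fromList g {xs} xs! = ≈-trans (∑∈-split g (fromList xs) xs! ∈-fromList⁺)
    (≈-trans (∙-congˡ (∑∈-vanishing g (removeAll (fromList xs) xs) λ i i∈ →
       let i∈xs , i∉xs = removeAll⁻ (fromList xs) xs i∈
       in ⊥-elim (i∉xs (∈-fromList⁻ xs i∈xs))))
    (identityʳ _))

unique-∷ : ∀ {A : Set} {x : A} {xs} → x ∉ˡ xs → Unique xs → Unique (x ∷ xs)
unique-∷ x∉ xs! = All.tabulate (λ y∈ x≡y → x∉ (subst (_∈ˡ _) (sym x≡y) y∈)) ∷ xs!

unique-∷⁻ : ∀ {A : Set} {x : A} {xs} → Unique (x ∷ xs) → x ∉ˡ xs × Unique xs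
unique-∷⁻ (x≢ ∷ xs!) = (λ x∈ → All.lookup x≢ x∈ refl) , xs!

-- Walks and simple paths in a multigraph.

module Walks (G : Graph) where

  open import Data.List.Membership.DecPropositional (_≟_ {order G}) using () renaming (_∈?_ to _∈ˡ?_)

  V = Fin (order G)
  E = Fin (size G)

  Incident : E → V → Set
  Incident h z = end₁ G h ≡ z ⊎ end₂ G h ≡ z

  joins-sym : ∀ {h a b} → Joins G h a b → Joins G h b a
  joins-sym (inj₁ p) = inj₂ p
  joins-sym (inj₂ p) = inj₁ p

  joins-incidentˡ : ∀ {h a b} → Joins G h a b → Incident h a
  joins-incidentˡ (inj₁ (p , _)) = inj₁ p
  joins-incidentˡ (inj₂ (_ , p)) = inj₂ p

  joins-incidentʳ : ∀ {h a b} → Joins G h a b → Incident h b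
  joins-incidentʳ = joins-incidentˡ ∘ joins-sym

  incident-end : ∀ {h a b z} → Joins G h a b → Incident h z → z ≡ a ⊎ z ≡ b
  incident-end (inj₁ (refl , refl)) (inj₁ refl) = inj₁ refl
  incident-end (inj₁ (refl , refl)) (inj₂ refl) = inj₂ refl
  incident-end (inj₂ (refl , refl)) (inj₁ refl) = inj₂ refl
  incident-end (inj₂ (refl , refl)) (inj₂ refl) = inj₁ refl

  incident-joins : ∀ {h z} → Incident h z → ∃ λ y → Joins G h z y
  incident-joins (inj₁ p) = _ , inj₁ (p , refl)
  incident-joins (inj₂ p) = _ , inj₂ (refl , p)

  subgraph-incident : ∀ {H : Piece G} {h z} → IsSubgraph H → h ∈ edges H → Incident h z → z ∈ verts H
  subgraph-incident H-sub h∈ (inj₁ refl) = proj₁ (H-sub _ h∈)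
  subgraph-incident H-sub h∈ (inj₂ refl) = proj₂ (H-sub _ h∈)

  data Walk : V → V → Set where
    stop : ∀ {a} → Walk a a
    step : ∀ {a b c} (h : E) → Joins G h a b → Walk b c → Walk a c

  vertexList : ∀ {a b} → Walk a b → List V
  vertexList {a} stop         = a ∷ []
  vertexList {a} (step _ _ W) = a ∷ vertexList W

  edgeList : ∀ {a b} → Walk a b → List E
  edgeList stop         = []
  edgeList (step h _ W) = h ∷ edgeList W

  infix 4 _∈ᵛ_ _∈ᵉ_

  _∈ᵛ_ : ∀ {a b} → V → Walk a b → Set
  z ∈ᵛ W = z ∈ˡ vertexList W

  _∈ᵉ_ : ∀ {a b} → E → Walk a b → Set
  h ∈ᵉ W = h ∈ˡ edgeList W

  _∈ᵛ?_ : ∀ {a b} z (W : Walk a b) → Dec (z ∈ᵛ W)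
  z ∈ᵛ? W = z ∈ˡ? vertexList W

  first∈ : ∀ {a b} (W : Walk a b) → a ∈ᵛ W
  first∈ stop         = here refl
  first∈ (step _ _ _) = here refl

  last∈ : ∀ {a b} (W : Walk a b) → b ∈ᵛ W
  last∈ stop         = here refl
  last∈ (step _ _ W) = there (last∈ W)

  edge-end∈ : ∀ {a b h z} (W : Walk a b) → h ∈ᵉ W → Incident h z → z ∈ᵛ W
  edge-end∈ (step h j W) (here refl) i with incident-end j i
  ... | inj₁ refl = here refl
  ... | inj₂ refl = there (first∈ W)
  edge-end∈ (step h j W) (there h∈) i = there (edge-end∈ W h∈ i)

  vertex-reached : ∀ {a b z} (W : Walk a b) → z ∈ᵛ W → z ≡ a ⊎ ∃ λ h → h ∈ᵉ W × Incident h z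
  vertex-reached stop         (here p) = inj₁ p
  vertex-reached (step h j W) (here p) = inj₁ p
  vertex-reached (step h j W) (there z∈) with vertex-reached W z∈
  ... | inj₁ refl            = inj₂ (h , here refl , joins-incidentʳ j)
  ... | inj₂ (g , g∈ , i)    = inj₂ (g , there g∈ , i)

  vertex-edge : ∀ {a b z} (W : Walk a b) → a ≢ b → z ∈ᵛ W → ∃ λ h → h ∈ᵉ W × Incident h z
  vertex-edge W a≢b z∈ with vertex-reached W z∈
  ... | inj₂ found = found
  vertex-edge stop         a≢b _ | inj₁ refl = ⊥-elim (a≢b refl)
  vertex-edge (step h j W) _   _ | inj₁ refl = h , here refl , joins-incidentˡ j

  infixr 5 _⁀_

  _⁀_ : ∀ {a b c} → Walk a b → Walk b c → Walk a c
  stop       ⁀ B = B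
  step h j A ⁀ B = step h j (A ⁀ B)

  ⁀-assoc : ∀ {a b c d} (A : Walk a b) (B : Walk b c) (C : Walk c d) → (A ⁀ B) ⁀ C ≡ A ⁀ B ⁀ C
  ⁀-assoc stop         B C = refl
  ⁀-assoc (step h j A) B C = cong (step h j) (⁀-assoc A B C)

  ∈ᵛ-⁀⁻ : ∀ {a b c z} (A : Walk a b) {B : Walk b c} → z ∈ᵛ A ⁀ B → z ∈ᵛ A ⊎ z ∈ᵛ B
  ∈ᵛ-⁀⁻ stop         z∈         = inj₂ z∈
  ∈ᵛ-⁀⁻ (step h j A) (here p)   = inj₁ (here p)
  ∈ᵛ-⁀⁻ (step h j A) (there z∈) = Sum.map₁ there (∈ᵛ-⁀⁻ A z∈)

  ∈ᵛ-⁀ˡ : ∀ {a b c z} (A : Walk a b) {B : Walk b c} → z ∈ᵛ A → z ∈ᵛ A ⁀ B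
  ∈ᵛ-⁀ˡ stop         {B} (here refl) = first∈ B
  ∈ᵛ-⁀ˡ (step h j A) (here p)        = here p
  ∈ᵛ-⁀ˡ (step h j A) (there z∈)      = there (∈ᵛ-⁀ˡ A z∈)

  ∈ᵛ-⁀ʳ : ∀ {a b c z} (A : Walk a b) {B : Walk b c} → z ∈ᵛ B → z ∈ᵛ A ⁀ B
  ∈ᵛ-⁀ʳ stop         z∈ = z∈
  ∈ᵛ-⁀ʳ (step h j A) z∈ = there (∈ᵛ-⁀ʳ A z∈)

  ∈ᵉ-⁀⁻ : ∀ {a b c h} (A : Walk a b) {B : Walk b c} → h ∈ᵉ A ⁀ B → h ∈ᵉ A ⊎ h ∈ᵉ B
  ∈ᵉ-⁀⁻ stop         h∈         = inj₂ h∈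
  ∈ᵉ-⁀⁻ (step h j A) (here p)   = inj₁ (here p)
  ∈ᵉ-⁀⁻ (step h j A) (there h∈) = Sum.map₁ there (∈ᵉ-⁀⁻ A h∈)

  ∈ᵉ-⁀ˡ : ∀ {a b c h} (A : Walk a b) {B : Walk b c} → h ∈ᵉ A → h ∈ᵉ A ⁀ B
  ∈ᵉ-⁀ˡ (step h j A) (here p)   = here p
  ∈ᵉ-⁀ˡ (step h j A) (there h∈) = there (∈ᵉ-⁀ˡ A h∈)

  ∈ᵉ-⁀ʳ : ∀ {a b c h} (A : Walk a b) {B : Walk b c} → h ∈ᵉ B → h ∈ᵉ A ⁀ B
  ∈ᵉ-⁀ʳ stop         h∈ = h∈
  ∈ᵉ-⁀ʳ (step h j A) h∈ = there (∈ᵉ-⁀ʳ A h∈)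

  edge : ∀ {h a b} → Joins G h a b → Walk a b
  edge j = step _ j stop

  rev : ∀ {a b} → Walk a b → Walk b a
  rev stop         = stop
  rev (step h j W) = rev W ⁀ edge (joins-sym j)

  ∈ᵛ-rev⁻ : ∀ {a b z} (W : Walk a b) → z ∈ᵛ rev W → z ∈ᵛ W
  ∈ᵛ-rev⁻ stop         z∈ = z∈
  ∈ᵛ-rev⁻ (step h j W) z∈ with ∈ᵛ-⁀⁻ (rev W) z∈
  ... | inj₁ z∈W                 = there (∈ᵛ-rev⁻ W z∈W)
  ... | inj₂ (here refl)         = there (first∈ W)
  ... | inj₂ (there (here refl)) = here refl

  ∈ᵛ-rev⁺ : ∀ {a b z} (W : Walk a b) → z ∈ᵛ W → z ∈ᵛ rev W
  ∈ᵛ-rev⁺ stop         z∈          = z∈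
  ∈ᵛ-rev⁺ (step h j W) (here refl) = ∈ᵛ-⁀ʳ (rev W) (there (here refl))
  ∈ᵛ-rev⁺ (step h j W) (there z∈)  = ∈ᵛ-⁀ˡ (rev W) (∈ᵛ-rev⁺ W z∈)

  ∈ᵉ-rev⁻ : ∀ {a b h} (W : Walk a b) → h ∈ᵉ rev W → h ∈ᵉ W
  ∈ᵉ-rev⁻ (step h j W) h∈ with ∈ᵉ-⁀⁻ (rev W) h∈
  ... | inj₁ h∈W         = there (∈ᵉ-rev⁻ W h∈W)
  ... | inj₂ (here refl) = here refl

  ∈ᵉ-rev⁺ : ∀ {a b h} (W : Walk a b) → h ∈ᵉ W → h ∈ᵉ rev W
  ∈ᵉ-rev⁺ (step h j W) (here refl) = ∈ᵉ-⁀ʳ (rev W) (here refl)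
  ∈ᵉ-rev⁺ (step h j W) (there h∈)  = ∈ᵉ-⁀ˡ (rev W) (∈ᵉ-rev⁺ W h∈)

  Simple : ∀ {a b} → Walk a b → Set
  Simple W = Unique (vertexList W)

  Meet : ∀ {a b c d} → Walk a b → Walk c d → (V → Set) → Set
  Meet A B P = ∀ {z} → z ∈ᵛ A → z ∈ᵛ B → P z

  simple-stop : ∀ {a} → Simple {a} stop
  simple-stop = [] ∷ []

  ⁀-simple⁺ : ∀ {a b c} (A : Walk a b) {B : Walk b c} →
    Simple A → Simple B → Meet A B (_≡ b) → Simple (A ⁀ B)
  ⁀-simple⁺ stop         A! B! meet = B!
  ⁀-simple⁺ (step h j A) A! B! meet with unique-∷⁻ A!
  ... | a∉A , A′! = unique-∷
    (λ a∈ → [ a∉A , (λ a∈B → a∉A (subst (_∈ᵛ A) (sym (meet (here refl) a∈B)) (last∈ A))) ] (∈ᵛ-⁀⁻ A a∈))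
    (⁀-simple⁺ A A′! B! (meet ∘ there))

  ⁀-simple⁻ : ∀ {a b c} (A : Walk a b) {B : Walk b c} → Simple (A ⁀ B) →
    Simple A × Simple B × Meet A B (_≡ b)
  ⁀-simple⁻ stop         AB! = simple-stop , AB! , λ { (here p) _ → p }
  ⁀-simple⁻ (step h j A) AB! with unique-∷⁻ AB!
  ... | a∉ , A′B! with ⁀-simple⁻ A A′B!
  ... | A! , B! , meet = unique-∷ (a∉ ∘ ∈ᵛ-⁀ˡ A) A! , B! ,
    λ { (here refl) z∈B → ⊥-elim (a∉ (∈ᵛ-⁀ʳ A z∈B)) ; (there z∈A) z∈B → meet z∈A z∈B }

  edge-simple : ∀ {h a b} (j : Joins G h a b) → a ≢ b → Simple (edge j)
  edge-simple j a≢b = unique-∷ (λ { (here p) → a≢b p }) simple-stop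

  rev-simple : ∀ {a b} (W : Walk a b) → Simple W → Simple (rev W)
  rev-simple stop         W! = W!
  rev-simple (step h j W) W! with unique-∷⁻ W!
  ... | a∉ , W′! = ⁀-simple⁺ (rev W) (rev-simple W W′!)
    (edge-simple (joins-sym j) (λ { refl → a∉ (first∈ W) }))
    λ { _ (here p) → p ; z∈ (there (here refl)) → ⊥-elim (a∉ (∈ᵛ-rev⁻ W z∈)) }

  simple⇒edges-unique : ∀ {a b} (W : Walk a b) → Simple W → Unique (edgeList W)
  simple⇒edges-unique stop         W! = []
  simple⇒edges-unique (step h j W) W! with unique-∷⁻ W!
  ... | a∉ , W′! = unique-∷ (λ h∈ → a∉ (edge-end∈ W h∈ (joins-incidentˡ j))) (simple⇒edges-unique W W′!)

  simple-edge-initial : ∀ {a b h} (W : Walk a b) → Simple W → h ∈ᵉ W → ∃ λ z → z ∈ᵛ W × Incident h z × z ≢ b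
  simple-edge-initial (step h j W) W! (here refl) =
    _ , here refl , joins-incidentˡ j , λ { refl → proj₁ (unique-∷⁻ W!) (last∈ W) }
  simple-edge-initial (step h j W) W! (there h∈) with simple-edge-initial W (proj₂ (unique-∷⁻ W!)) h∈
  ... | z , z∈ , i , z≢ = z , there z∈ , i , z≢

  split : ∀ {a b z} (W : Walk a b) → z ∈ᵛ W → ∃₂ λ (A : Walk a z) (B : Walk z b) → W ≡ A ⁀ B
  split stop         (here refl) = stop , stop , refl
  split (step h j W) (here refl) = stop , step h j W , refl
  split (step h j W) (there z∈)  with split W z∈
  ... | A , B , refl = step h j A , B , refl

  record FirstHit (P : V → Set) {a b} (W : Walk a b) : Set where
    field
      {target}  : V
      walk      : Walk a target
      simple    : Simple walk
      hit       : P target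
      only      : ∀ {z} → z ∈ᵛ walk → P z → z ≡ target
      verts⊆    : ∀ {z} → z ∈ᵛ walk → z ∈ᵛ W
      edges⊆    : ∀ {h} → h ∈ᵉ walk → h ∈ᵉ W

  -- Truncation and loop erasure at once: if the new first vertex already occurs on the truncated
  -- walk, only the tail from that occurrence is kept. With `P` equality to the last vertex, this
  -- extracts a simple path.
  firstHit : ∀ {P : V → Set} → Decidable P → ∀ {a b} (W : Walk a b) → P b → FirstHit P W
  firstHit P? stop Pb = record
    { walk = stop ; simple = simple-stop ; hit = Pb ; only = λ { (here p) _ → p }
    ; verts⊆ = id ; edges⊆ = id }
  firstHit P? {a} (step h j W) Pb with P? a
  ... | yes Pa = record
    { walk = stop ; simple = simple-stop ; hit = Pa ; only = λ { (here p) _ → p }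
    ; verts⊆ = λ { (here p) → here p } ; edges⊆ = λ () }
  ... | no ¬Pa with firstHit P? W Pb
  ... | record { walk = W′ ; simple = W′! ; hit = hit ; only = only ; verts⊆ = verts⊆ ; edges⊆ = edges⊆ }
      with a ∈ᵛ? W′
  ...   | no a∉ = record
    { walk = step h j W′ ; simple = unique-∷ a∉ W′! ; hit = hit
    ; only = λ { (here refl) Pa → ⊥-elim (¬Pa Pa) ; (there z∈) Pz → only z∈ Pz }
    ; verts⊆ = λ { (here p) → here p ; (there z∈) → there (verts⊆ z∈) }
    ; edges⊆ = λ { (here p) → here p ; (there h∈) → there (edges⊆ h∈) } }
  ...   | yes a∈ with split W′ a∈
  ...     | A , B , refl = record
    { walk = B ; simple = proj₁ (proj₂ (⁀-simple⁻ A W′!)) ; hit = hit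
    ; only = only ∘ ∈ᵛ-⁀ʳ A
    ; verts⊆ = there ∘ verts⊆ ∘ ∈ᵛ-⁀ʳ A
    ; edges⊆ = there ∘ edges⊆ ∘ ∈ᵉ-⁀ʳ A }

  adjacent-sym : ∀ {H : Piece G} {a b} → Adjacent H a b → Adjacent H b a
  adjacent-sym (h , h∈ , j) = h , h∈ , joins-sym j

  walk⇒star : ∀ (H : Piece G) {a b z} (W : Walk a b) → (∀ {h} → h ∈ᵉ W → h ∈ edges H) →
    z ∈ᵛ W → Star (Adjacent H) a z
  walk⇒star H stop         W⊆H (here refl) = ε
  walk⇒star H (step h j W) W⊆H (here refl) = ε
  walk⇒star H (step h j W) W⊆H (there z∈)  =
    (h , W⊆H (here refl) , j) ◅ walk⇒star H W (W⊆H ∘ there) z∈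

  walk⇒star˘ : ∀ (H : Piece G) {a b z} (W : Walk a b) → (∀ {h} → h ∈ᵉ W → h ∈ edges H) →
    z ∈ᵛ W → Star (Adjacent H) z a
  walk⇒star˘ H stop         W⊆H (here refl) = ε
  walk⇒star˘ H (step h j W) W⊆H (here refl) = ε
  walk⇒star˘ H (step h j W) W⊆H (there z∈)  =
    walk⇒star˘ H W (W⊆H ∘ there) z∈ ◅◅ ((h , W⊆H (here refl) , joins-sym j) ◅ ε)

  -- Degrees along a walk, and closing a path to a circle.

  open SubsetSum +-0-commutativeMonoid public

  δ : V → V → ℕ
  δ x z = if does (x ≟ z) then 1 else 0

  δ-refl : ∀ z → δ z z ≡ 1
  δ-refl z rewrite dec-true (z ≟ z) refl = refl

  δ-≢ : ∀ {x z} → x ≢ z → δ x z ≡ 0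
  δ-≢ {x} {z} x≢z rewrite dec-false (x ≟ z) x≢z = refl

  inc : V → E → ℕ
  inc z h = δ (end₁ G h) z + δ (end₂ G h) z

  inc-joins : ∀ {h a b} → Joins G h a b → ∀ z → inc z h ≡ δ a z + δ b z
  inc-joins (inj₁ (refl , refl)) z = refl
  inc-joins {h} (inj₂ (refl , refl)) z = +-comm (δ (end₁ G h) z) (δ (end₂ G h) z)

  count : V → List V → ℕ
  count z = foldr (λ x n → δ x z + n) 0

  count-∉ : ∀ {z} xs → z ∉ˡ xs → count z xs ≡ 0
  count-∉ []       z∉ = refl
  count-∉ (x ∷ xs) z∉ = cong₂ _+_ (δ-≢ (z∉ ∘ here ∘ sym)) (count-∉ xs (z∉ ∘ there))

  count-∈ : ∀ {z xs} → Unique xs → z ∈ˡ xs → count z xs ≡ 1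
  count-∈ {z} xs!@(_ ∷ _) (here refl) =
    cong₂ _+_ (δ-refl z) (count-∉ _ (proj₁ (unique-∷⁻ xs!)))
  count-∈ {z} (x≢ ∷ xs!) (there z∈)  = cong₂ _+_ (δ-≢ (All.lookup x≢ z∈)) (count-∈ xs! z∈)

  -- Each visit to `z` accounts for two edge ends, except that the first vertex has no arrival and
  -- the last no departure; `δ a z` and `δ b z` make up for these. A closing edge later supplies the
  -- same two ends.
  inc-walk : ∀ {a b} (W : Walk a b) z →
    ∑ˡ (inc z) (edgeList W) + δ a z + δ b z ≡ count z (vertexList W) + count z (vertexList W)
  inc-walk {a} stop z = rearr (δ a z)
    where
    rearr : ∀ x → x + x ≡ x + 0 + (x + 0)
    rearr = solve-∀
  inc-walk {a} {b} (step {b = w} h j W) z rewrite inc-joins j z =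
    trans (rearr₁ (δ a z) (δ w z) (∑ˡ (inc z) (edgeList W)) (δ b z))
      (trans (cong (δ a z + δ a z +_) (inc-walk W z)) (rearr₂ (δ a z) _))
    where
    rearr₁ : ∀ p q s t → p + q + s + p + t ≡ p + p + (s + q + t)
    rearr₁ = solve-∀
    rearr₂ : ∀ p c → p + p + (c + c) ≡ p + c + (p + c)
    rearr₂ = solve-∀

  inc-closed-walk : ∀ {a b h} (W : Walk a b) → Joins G h b a → Simple W → ∀ {z} → z ∈ᵛ W →
    ∑ˡ (inc z) (h ∷ edgeList W) ≡ 2
  inc-closed-walk {a} {b} W j W! {z} z∈ rewrite inc-joins j z =
    trans (rearr (δ b z) (δ a z) _)
    (trans (inc-walk W z) (cong (λ n → n + n) (count-∈ W! z∈)))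
    where
    rearr : ∀ p q s → p + q + s ≡ s + q + p
    rearr = solve-∀

  closure : ∀ {a b} → Walk a b → E → Piece G
  closure W h = piece (fromList (vertexList W)) (fromList (h ∷ edgeList W))

  -- The condition `¬ h ∈ᵉ W` rules out a single edge traversed there and back.
  closure-isCircle : ∀ {a b h} (W : Walk a b) → Joins G h b a → Simple W → ¬ h ∈ᵉ W →
    IsCircle (closure W h)
  closure-isCircle {a} {b} {h} W j W! h∉ = sub , ((a , ∈-fromList⁺ (first∈ W)) , conn) , deg
    where
    W⊆ : ∀ {g} → g ∈ᵉ W → g ∈ edges (closure W h)
    W⊆ = ∈-fromList⁺ ∘ there
    sub : IsSubgraph (closure W h)
    sub g g∈ = ∈-fromList⁺ (end∈ g∈l (inj₁ refl)) , ∈-fromList⁺ (end∈ g∈l (inj₂ refl))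
      where
      g∈l = ∈-fromList⁻ (h ∷ edgeList W) g∈
      end∈ : ∀ {z} → g ∈ˡ h ∷ edgeList W → Incident g z → z ∈ᵛ W
      end∈ (there g∈W) i = edge-end∈ W g∈W i
      end∈ (here refl) i with incident-end j i
      ... | inj₁ refl = last∈ W
      ... | inj₂ refl = first∈ W
    conn : ∀ u v → u ∈ _ → v ∈ _ → Star (Adjacent (closure W h)) u v
    conn u v u∈ v∈ = walk⇒star˘ (closure W h) W W⊆ (∈-fromList⁻ _ u∈) ◅◅ walk⇒star (closure W h) W W⊆ (∈-fromList⁻ _ v∈)
    deg : ∀ v → v ∈ _ → degree (closure W h) v ≡ 2
    deg v v∈ = trans (∑∈-fromList (inc v) (unique-∷ h∉ (simple⇒edges-unique W W!)))
      (inc-closed-walk W j W! (∈-fromList⁻ _ v∈))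

lookup-injective : ∀ {A : Set} {xs : List A} → Unique xs → ∀ {i j} →
  List.lookup xs i ≡ List.lookup xs j → i ≡ j
lookup-injective (_ ∷ _)    {zero}  {zero}  _  = refl
lookup-injective (x≢ ∷ _)   {zero}  {suc j} eq = ⊥-elim (All.lookup x≢ (∈-lookup j) eq)
lookup-injective (x≢ ∷ _)   {suc i} {zero}  eq = ⊥-elim (All.lookup x≢ (∈-lookup i) (sym eq))
lookup-injective (_ ∷ xs!)  {suc i} {suc j} eq = cong suc (lookup-injective xs! eq)

unique⇒length≤ : ∀ {n} {xs : List (Fin n)} → Unique xs → length xs ≤ n
unique⇒length≤ xs! = injective⇒≤ (lookup-injective xs!)

-- Opening a circle at an edge.

module Traversals (G : Graph) (loopless : ∀ h → end₁ G h ≢ end₂ G h) where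

  open Walks G

  joins-≢ : ∀ {h a b} → Joins G h a b → a ≢ b
  joins-≢ (inj₁ (refl , refl)) = loopless _
  joins-≢ (inj₂ (refl , refl)) = loopless _ ∘ sym

  ∑∈-nonzero : ∀ {n} (g : Fin n → ℕ) S → ∑∈ g S ≢ 0 → ∃ λ i → i ∈ S × g i ≢ 0
  ∑∈-nonzero g []         ≢0 = ⊥-elim (≢0 refl)
  ∑∈-nonzero g (false ∷ S) ≢0 with ∑∈-nonzero (g ∘ suc) S ≢0
  ... | i , i∈ , gi = suc i , there i∈ , gi
  ∑∈-nonzero g (true ∷ S) ≢0 with g zero in eq
  ... | suc _ = zero , here , λ g0 → contradiction (trans (sym eq) g0) λ ()
  ... | zero with ∑∈-nonzero (g ∘ suc) S ≢0
  ...   | i , i∈ , gi = suc i , there i∈ , gi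

  inc≢0⇒incident : ∀ {h z} → inc z h ≢ 0 → Incident h z
  inc≢0⇒incident {h} {z} ≢0 with end₁ G h ≟ z | end₂ G h ≟ z
  ... | yes p | _     = inj₁ p
  ... | no _  | yes q = inj₂ q
  ... | no _  | no _  = ⊥-elim (≢0 refl)

  incident⇒inc≥1 : ∀ {h z} → Incident h z → 1 ≤ inc z h
  incident⇒inc≥1 {h} {z} (inj₁ refl) rewrite δ-refl z = s≤s z≤n
  incident⇒inc≥1 {h} {z} (inj₂ refl) rewrite δ-refl z = m≤n+m 1 _

  module _ {H : Piece G} {l : List E} (l! : Unique l) (l⊆ : ∀ {h} → h ∈ˡ l → h ∈ edges H) where

    extra-edge-degree : ∀ {h z} → h ∈ edges H → h ∉ˡ l → Incident h z →
      suc (∑ˡ (inc z) l) ≤ degree H z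
    extra-edge-degree {h} {z} h∈ h∉ i = ≤-trans (+-monoˡ-≤ _ (incident⇒inc≥1 i))
      (≤-trans (m≤m+n _ _) (≤-reflexive (sym
        (∑∈-split (inc z) (edges H) (unique-∷ h∉ l!) λ { (here refl) → h∈ ; (there g∈) → l⊆ g∈ }))))

    find-extra-edge : ∀ {z} → ∑ˡ (inc z) l ≢ degree H z → ∃ λ h → h ∈ edges H × h ∉ˡ l × Incident h z
    find-extra-edge {z} ≢deg with ∑∈-nonzero (inc z) (removeAll (edges H) l) (λ ≡0 → ≢deg (sym
      (trans (∑∈-split (inc z) (edges H) l! l⊆) (trans (cong (∑ˡ (inc z) l +_) ≡0) (+-identityʳ _)))))
    ... | h , h∈ , i with removeAll⁻ (edges H) l h∈
    ... | h∈H , h∉l = h , h∈H , h∉l , inc≢0⇒incident i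

  -- `IsCircle` provides no order on the circle. Opening it at `e` recovers one, so that arcs can be
  -- cut out of a walk.
  record Traversal (H : Piece G) (e : E) (u v : V) : Set where
    field
      path   : Walk u v
      simple : Simple path
      omits  : ¬ e ∈ᵉ path
      verts⊇ : ∀ {z} → z ∈ verts H → z ∈ᵛ path
      edges⊆ : ∀ {h} → h ∈ᵉ path → h ∈ edges H
      edges⊇ : ∀ {h} → h ∈ edges H → h ∈ˡ e ∷ edgeList path

  module _ {H : Piece G} (H-circle : IsCircle H) {e : E} (e∈ : e ∈ edges H)
           {u v : V} (e-joins : Joins G e v u) where

    private
      H-sub = proj₁ H-circle
      H-deg = proj₂ (proj₂ H-circle)

      -- With `e`, the path already has degree 2 at each of its vertices, so no further edge of `H`
      -- can leave it; connectedness then puts all of `H` on it.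
      traversal : (W : Walk u v) → Simple W → ¬ e ∈ᵉ W → (∀ {h} → h ∈ᵉ W → h ∈ edges H) →
        Traversal H e u v
      traversal W W! e∉ W⊆ = record
        { path = W ; simple = W! ; omits = e∉ ; edges⊆ = W⊆
        ; verts⊇ = λ z∈ → reach (proj₂ (proj₁ (proj₂ H-circle)) u _ u∈ z∈) (first∈ W)
        ; edges⊇ = λ {h} h∈ → saturated
            (reach (proj₂ (proj₁ (proj₂ H-circle)) u _ u∈ (proj₁ (H-sub h h∈))) (first∈ W)) h∈ (inj₁ refl) }
        where
        u∈ : u ∈ verts H
        u∈ = subgraph-incident {H} H-sub e∈ (joins-incidentʳ e-joins)
        l⊆ : ∀ {h} → h ∈ˡ e ∷ edgeList W → h ∈ edges H
        l⊆ (here refl) = e∈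
        l⊆ (there h∈)  = W⊆ h∈
        l! : Unique (e ∷ edgeList W)
        l! = unique-∷ e∉ (simple⇒edges-unique W W!)
        verts⊆ : ∀ {z} → z ∈ᵛ W → z ∈ verts H
        verts⊆ {z} z∈ with z ≟ v
        ... | yes refl = subgraph-incident {H} H-sub e∈ (joins-incidentˡ e-joins)
        ... | no z≢v = inner W z∈ W⊆ z≢v
          where
          inner : ∀ {a b} (X : Walk a b) → z ∈ᵛ X → (∀ {h} → h ∈ᵉ X → h ∈ edges H) → z ≢ b → z ∈ verts H
          inner stop (here p) _ z≢ = ⊥-elim (z≢ p)
          inner (step h j X) (here refl) X⊆ _ = subgraph-incident {H} H-sub (X⊆ (here refl)) (joins-incidentˡ j)
          inner (step h j X) (there z∈X) X⊆ z≢ = inner X z∈X (X⊆ ∘ there) z≢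
        open import Data.List.Membership.DecPropositional (_≟_ {size G}) using () renaming (_∈?_ to _∈ᵉ?_)
        saturated : ∀ {h z} → z ∈ᵛ W → h ∈ edges H → Incident h z → h ∈ˡ e ∷ edgeList W
        saturated {h} {z} z∈ h∈ i with h ∈ᵉ? (e ∷ edgeList W)
        ... | yes h∈l = h∈l
        ... | no h∉l  = ⊥-elim (1+n≰n (≤-trans
                (≤-reflexive (cong suc (sym (inc-closed-walk W e-joins W! z∈))))
                (≤-trans (extra-edge-degree {H} l! l⊆ h∈ h∉l i) (≤-reflexive (H-deg z (verts⊆ z∈))))))
        reach : ∀ {y z} → Star (Adjacent H) y z → y ∈ᵛ W → z ∈ᵛ W
        reach ε                     y∈ = y∈
        reach ((h , h∈ , j) ◅ rest) y∈ = reach rest (next (saturated y∈ h∈ (joins-incidentˡ j)))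
          where
          next : h ∈ˡ e ∷ edgeList W → _ ∈ᵛ W
          next (there h∈W) = edge-end∈ W h∈W (joins-incidentʳ j)
          next (here refl) with incident-end e-joins (joins-incidentʳ j)
          ... | inj₁ refl = last∈ W
          ... | inj₂ refl = first∈ W

      module _ {x : V} (W : Walk x v) (W! : Simple W) (u∉ : ¬ u ∈ᵛ W)
               (x∈ : x ∈ verts H) (W⊆ : ∀ {h} → h ∈ᵉ W → h ∈ edges H) where

        e∷W! : Unique (e ∷ edgeList W)
        e∷W! = unique-∷ (λ e∈W → u∉ (edge-end∈ W e∈W (joins-incidentʳ e-joins)))
                        (simple⇒edges-unique W W!)

        e∷W⊆ : ∀ {h} → h ∈ˡ e ∷ edgeList W → h ∈ edges H
        e∷W⊆ (here refl) = e∈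
        e∷W⊆ (there h∈)  = W⊆ h∈

        -- Every vertex of `W` has both its edges in `e ∷ edgeList W`, except the free end `x`,
        -- which has one; `δ x z` stands for the missing one.
        inc-e∷W : ∀ {z} → z ∈ᵛ W → ∑ˡ (inc z) (e ∷ edgeList W) + δ x z ≡ 2
        inc-e∷W {z} z∈ rewrite inc-joins e-joins z | δ-≢ {u} {z} (λ { refl → u∉ z∈ }) =
          trans (rearr (δ v z) _ (δ x z))
            (trans (inc-walk W z) (cong (λ n → n + n) (count-∈ W! z∈)))
          where
          rearr : ∀ p s q → p + 0 + s + q ≡ s + q + p
          rearr = solve-∀

        -- Degree 2 supplies an edge at x outside e ∷ W and leaves no room for it to end
        -- at another vertex of W.
        next-edge : ∃₂ λ h y → h ∈ edges H × h ∉ˡ e ∷ edgeList W × Joins G h y x × ¬ y ∈ᵛ W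
        next-edge with find-extra-edge {H} e∷W! e∷W⊆ {x} (λ eq → contradiction
            (trans (sym (inc-e∷W (first∈ W))) (cong₂ _+_ (trans eq (H-deg x x∈)) (δ-refl x))) λ ())
        ... | h , h∈ , h∉ , i with incident-joins i
        ... | y , j = h , y , h∈ , h∉ , joins-sym j , λ y∈ →
          1+n≰n (≤-trans (≤-reflexive (cong suc (sym (trans (sym (+-identityʳ _))
              (trans (cong (∑ˡ (inc y) (e ∷ edgeList W) +_) (sym (δ-≢ (joins-≢ j)))) (inc-e∷W y∈))))))
            (≤-trans (extra-edge-degree {H} e∷W! e∷W⊆ h∈ h∉ (joins-incidentʳ j))
              (≤-reflexive (H-deg y (subgraph-incident {H} H-sub h∈ (joins-incidentʳ j))))))

      grow : ∀ k {x} (W : Walk x v) → length (vertexList W) + k ≡ order G → Simple W → ¬ u ∈ᵛ W →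
        x ∈ verts H → (∀ {h} → h ∈ᵉ W → h ∈ edges H) → Traversal H e u v
      grow zero W len W! u∉ _ _ = ⊥-elim (1+n≰n (≤-trans (unique⇒length≤ (unique-∷ u∉ W!))
        (≤-reflexive (trans (sym len) (+-identityʳ _)))))
      grow (suc k) W len W! u∉ x∈ W⊆ with next-edge W W! u∉ x∈ W⊆
      ... | h , y , h∈ , h∉ , j , y∉ with y ≟ u
      ...   | yes refl = traversal (step h j W) (unique-∷ y∉ W!)
              (λ { (here refl) → h∉ (here refl)
                 ; (there e∈W) → u∉ (edge-end∈ W e∈W (joins-incidentʳ e-joins)) })
              λ { (here refl) → h∈ ; (there g∈) → W⊆ g∈ }
      ...   | no y≢u = grow k (step h j W) (trans (sym (+-suc _ k)) len) (unique-∷ y∉ W!)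
              (λ { (here p) → y≢u (sym p) ; (there u∈) → u∉ u∈ })
              (subgraph-incident {H} H-sub h∈ (joins-incidentˡ j))
              λ { (here refl) → h∈ ; (there g∈) → W⊆ g∈ }

    circle-traversal : Traversal H e u v
    circle-traversal = grow _ stop (m+[n∸m]≡n (1≤order u)) simple-stop
      (λ { (here p) → joins-≢ e-joins (sym p) })
      (subgraph-incident {H} H-sub e∈ (joins-incidentˡ e-joins)) λ ()
      where
      1≤order : ∀ {n} → Fin n → 1 ≤ n
      1≤order zero    = s≤s z≤n
      1≤order (suc _) = s≤s z≤n

-- Chains of edges linked at unblocked vertices.

module Linkage (G : Graph) where

  open Walks G

  -- Consecutive edges of a path that avoids Blocked at its inner vertices are linked.
  Linked : (V → Set) → E → E → Set
  Linked Blocked h h′ = ∃ λ w → ¬ Blocked w × Incident h w × Incident h′ w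

  linked-sym : ∀ {P h h′} → Star (Linked P) h h′ → Star (Linked P) h′ h
  linked-sym = Star.reverse λ (w , ¬Pw , i , i′) → w , ¬Pw , i′ , i

  incident-both : ∀ {h a b} → Incident h a → Incident h b → a ≢ b → Joins G h a b
  incident-both i i′ a≢b with incident-joins i
  ... | y , j with incident-end j i′
  ... | inj₁ refl = ⊥-elim (a≢b refl)
  ... | inj₂ refl = j

-- Ears of `C`, and why every edge outside `C` lies on one.

module Ears (G : Graph) (loopless : ∀ h → end₁ G h ≢ end₂ G h)
            (C : Piece G) (C-sub : IsSubgraph C) where

  open Walks G
  open Linkage G
  open Traversals G loopless using (joins-≢)

  On : V → Set
  On z = z ∈ verts C

  on-edge : ∀ {h z} → h ∈ edges C → Incident h z → On z
  on-edge = subgraph-incident {C} C-sub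

  -- `avoids` does not follow from `inner`: a single edge of `C` has all its vertices among its two
  -- ends.
  record Ear (a b : V) : Set where
    field
      path    : Walk a b
      simple  : Simple path
      ends≢   : a ≢ b
      first-on : On a
      last-on  : On b
      inner   : ∀ {z} → z ∈ᵛ path → On z → z ≡ a ⊎ z ≡ b
      avoids  : ∀ {h} → h ∈ᵉ path → h ∉ edges C

  open Ear public

  revEar : ∀ {a b} → Ear a b → Ear b a
  revEar P = record
    { path = rev (path P) ; simple = rev-simple (path P) (simple P) ; ends≢ = ends≢ P ∘ sym
    ; first-on = last-on P ; last-on = first-on P
    ; inner = λ z∈ on → Sum.swap (inner P (∈ᵛ-rev⁻ (path P) z∈) on)
    ; avoids = avoids P ∘ ∈ᵉ-rev⁻ (path P) }

  -- Successive edges of an ear share an inner vertex, which is off `C`. Both given edges are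
  -- reached from the first edge.
  ear-linked : ∀ {a b} (P : Ear a b) {h h′} → h ∈ᵉ path P → h′ ∈ᵉ path P → Star (Linked On) h h′
  ear-linked {a} {b} P h∈ h′∈ = join (path P) (simple P)
      (λ {z} z∈ → [ (λ on → Sum.map₂ inj₁ (inner P z∈ on)) , inj₂ ∘ inj₂ ] (on? z)) h∈ h′∈
    where
    on? : ∀ z → On z ⊎ ¬ On z
    on? z with z ∈? verts C
    ... | yes p = inj₁ p
    ... | no ¬p = inj₂ ¬p
    Inner : ∀ {x} → Walk x b → Set
    Inner {x} W = ∀ {z} → z ∈ᵛ W → z ≡ x ⊎ z ≡ b ⊎ ¬ On z
    from-first : ∀ {x y h h′} {j : Joins G h x y} (W : Walk y b) → Simple (step h j W) →
      Inner (step h j W) → h′ ∈ᵉ step h j W → Star (Linked On) h h′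
    from-first W _ _ (here refl) = ε
    from-first {x} {y} {h} {j = j} W@(step h₁ j₁ W₁) W! inn (there h′∈) =
      (y , y-off , joins-incidentʳ j , joins-incidentˡ j₁) ◅ from-first {j = j₁} W₁ (proj₂ x!)
        (λ z∈ → [ (λ { refl → ⊥-elim (proj₁ x! z∈) }) , inj₂ ] (inn (there z∈))) h′∈
      where
      x! = unique-∷⁻ W!
      y-off : ¬ On y
      y-off on with inn (there (here refl))
      ... | inj₁ refl        = proj₁ x! (here refl)
      ... | inj₂ (inj₁ refl) = proj₁ (unique-∷⁻ (proj₂ x!)) (last∈ W₁)
      ... | inj₂ (inj₂ off)  = off on
    join : ∀ {x} (W : Walk x b) → Simple W → Inner W →
      ∀ {h h′} → h ∈ᵉ W → h′ ∈ᵉ W → Star (Linked On) h h′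
    join (step _ j W) W! inn h∈ h′∈ =
      linked-sym (from-first {j = j} W W! inn h∈) ◅◅ from-first {j = j} W W! inn h′∈

  Attached : V → Set
  Attached z = On z ⊎ ∃₂ λ a b → ∃ λ (P : Ear a b) → z ∈ᵛ path P

  record Linking (p q : V) : Set where
    field
      {c d}    : V
      left     : Walk p c
      right    : Walk q d
      c-on     : On c
      d-on     : On d
      disjoint : ∀ {z} → z ∈ᵛ left → ¬ z ∈ᵛ right
      leftAttached  : ∀ {z} → z ∈ᵛ left → Attached z
      rightAttached : ∀ {z} → z ∈ᵛ right → Attached z

  record Escape (q t : V) : Set where
    field
      {d}      : V
      walk     : Walk q d
      d-on     : On d
      misses   : ¬ t ∈ᵛ walk
      attached : ∀ {z} → z ∈ᵛ walk → Attached z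

  -- `q` cuts its ear into two halves that meet only in `q`, so at least one half misses `t`.
  escape : ∀ {q t} → Attached q → q ≢ t → Escape q t
  escape (inj₁ on) q≢t = record
    { walk = stop ; d-on = on ; misses = λ { (here p) → q≢t (sym p) } ; attached = λ { (here refl) → inj₁ on } }
  escape {q} {t} (inj₂ (a , b , P , q∈)) q≢t with split (path P) q∈
  ... | A , B , eq = choose (t ∈ᵛ? A)
    where
    att : ∀ {z} → z ∈ᵛ A ⁀ B → Attached z
    att z∈ = inj₂ (a , b , P , subst (_ ∈ᵛ_) (sym eq) z∈)
    choose : Dec (t ∈ᵛ A) → Escape q t
    choose (no t∉A) = record
      { walk = rev A ; d-on = first-on P ; misses = t∉A ∘ ∈ᵛ-rev⁻ A
      ; attached = att ∘ ∈ᵛ-⁀ˡ A ∘ ∈ᵛ-rev⁻ A }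
    choose (yes t∈A) = record
      { walk = B ; d-on = last-on P
      ; misses = λ t∈B → q≢t (sym (proj₂ (proj₂ (⁀-simple⁻ A (subst Simple eq (simple P)))) t∈A t∈B))
      ; attached = att ∘ ∈ᵛ-⁀ʳ A }

  -- After meeting X at w ≠ p, B follows X away from p and leaves Y to p.
  reroute : ∀ {p q a b w} (X : Walk p a) (Y : Walk p b) (B : Walk q w) →
    Simple X → Meet X Y (_≡ p) → On a → On b →
    (∀ {z} → z ∈ᵛ X → Attached z) → (∀ {z} → z ∈ᵛ Y → Attached z) → (∀ {z} → z ∈ᵛ B → Attached z) →
    (∀ {z} → z ∈ᵛ B → z ∈ᵛ Y → z ≡ w) → w ∈ᵛ X → w ≢ p → Linking p q
  reroute {p} X Y B X! XY a-on b-on attX attY attB BY w∈X w≢p with split X w∈X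
  ... | X₁ , X₂ , refl = record
    { left = Y ; right = B ⁀ X₂ ; c-on = b-on ; d-on = a-on
    ; disjoint = λ z∈Y z∈ → [ (λ z∈B → w≢p (XY w∈X (subst (_∈ᵛ Y) (BY z∈B z∈Y) z∈Y)))
                            , (λ z∈X₂ → p∉X₂ (subst (_∈ᵛ X₂) (XY (∈ᵛ-⁀ʳ X₁ z∈X₂) z∈Y) z∈X₂)) ] (∈ᵛ-⁀⁻ B z∈)
    ; leftAttached = attY
    ; rightAttached = λ z∈ → [ attB , attX ∘ ∈ᵛ-⁀ʳ X₁ ] (∈ᵛ-⁀⁻ B z∈) }
    where
    p∉X₂ : ¬ p ∈ᵛ X₂
    p∉X₂ p∈ = w≢p (sym (proj₂ (proj₂ (⁀-simple⁻ X₁ X!)) (first∈ X₁) p∈))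

  -- When `p` lies on an ear, the ear offers it two routes `A` and `Y` to `C`. The walk from `q`
  -- that misses `p` is stopped at its first vertex on `A`, `Y` or `C`. If it runs into one route,
  -- it follows that route to `C` and `p` takes the other.
  linking : ∀ {p q} → Attached p → Attached q → p ≢ q → Linking p q
  linking (inj₁ on) q-att p≢q with escape q-att (p≢q ∘ sym)
  ... | record { walk = B ; d-on = d-on ; misses = p∉B ; attached = att } = record
    { left = stop ; right = B ; c-on = on ; d-on = d-on
    ; disjoint = λ { (here refl) → p∉B } ; leftAttached = λ { (here refl) → inj₁ on } ; rightAttached = att }
  linking {p} {q} (inj₂ (a , b , P , p∈)) q-att p≢q with escape q-att (p≢q ∘ sym) | split (path P) p∈
  ... | record { walk = B₀ ; d-on = d-on ; misses = p∉B ; attached = att } | A , Y , eq = choose (A∪Y? w)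
    where
    A∪Y? : ∀ z → Dec (z ∈ᵛ A ⊎ z ∈ᵛ Y)
    A∪Y? z = (z ∈ᵛ? A) ⊎-dec (z ∈ᵛ? Y)
    open FirstHit (firstHit (λ z → A∪Y? z ⊎-dec (z ∈? verts C)) B₀ (inj₂ d-on))
      renaming (target to w; walk to B; simple to B-simple)
    AY! : Simple (A ⁀ Y)
    AY! = subst Simple eq (simple P)
    earAtt : ∀ {z} → z ∈ᵛ A ⁀ Y → Attached z
    earAtt z∈ = inj₂ (a , b , P , subst (_ ∈ᵛ_) (sym eq) z∈)
    meet = proj₂ (proj₂ (⁀-simple⁻ A AY!))
    w≢p : w ≢ p
    w≢p w≡p = p∉B (verts⊆ (subst (_∈ᵛ B) w≡p (last∈ B)))
    choose : Dec (w ∈ᵛ A ⊎ w ∈ᵛ Y) → Linking p q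
    choose (yes (inj₁ w∈A)) = reroute (rev A) Y B (rev-simple A (proj₁ (⁀-simple⁻ A AY!)))
      (meet ∘ ∈ᵛ-rev⁻ A) (first-on P) (last-on P) (earAtt ∘ ∈ᵛ-⁀ˡ A ∘ ∈ᵛ-rev⁻ A) (earAtt ∘ ∈ᵛ-⁀ʳ A)
      (att ∘ verts⊆) (λ z∈B z∈Y → only z∈B (inj₁ (inj₂ z∈Y))) (∈ᵛ-rev⁺ A w∈A) w≢p
    choose (yes (inj₂ w∈Y)) = reroute Y (rev A) B (proj₁ (proj₂ (⁀-simple⁻ A AY!)))
      (λ z∈Y z∈A → meet (∈ᵛ-rev⁻ A z∈A) z∈Y) (last-on P) (first-on P) (earAtt ∘ ∈ᵛ-⁀ʳ A)
      (earAtt ∘ ∈ᵛ-⁀ˡ A ∘ ∈ᵛ-rev⁻ A)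
      (att ∘ verts⊆) (λ z∈B z∈A → only z∈B (inj₁ (inj₁ (∈ᵛ-rev⁻ A z∈A)))) w∈Y w≢p
    choose (no w∉) = record
      { left = Y ; right = B ; c-on = last-on P
      ; d-on = [ ⊥-elim ∘ w∉ , id ]′ hit
      ; disjoint = λ z∈Y z∈B → w∉ (inj₂ (subst (_∈ᵛ Y) (only z∈B (inj₁ (inj₂ z∈Y))) z∈Y))
      ; leftAttached = earAtt ∘ ∈ᵛ-⁀ʳ A ; rightAttached = att ∘ verts⊆ }

  -- Both linking walks are cut at their first vertex on `C` and spliced to `R`. Their vertices are
  -- attached and the inner vertices of `R` are not, so the three pieces meet only where they are
  -- joined.
  close-ear : ∀ {p q} → Linking p q → (R : Walk p q) → Simple R →
    (∀ {z} → z ∈ᵛ R → z ≡ p ⊎ z ≡ q ⊎ ¬ Attached z) → (∀ {h} → h ∈ᵉ R → h ∉ edges C) →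
    ∃₂ λ a b → ∃ λ (P : Ear a b) → ∀ {h} → h ∈ᵉ R → h ∈ᵉ path P
  close-ear {p} {q} L R R! R-inner R-avoids = _ , _ , record
      { path = rev A ⁀ R ⁀ B
      ; simple = ⁀-simple⁺ (rev A) (rev-simple A A!) (⁀-simple⁺ R R! B! R∩B) A∩RB
      ; ends≢ = λ eq → disj (last∈ A) (subst (_∈ᵛ B) (sym eq) (last∈ B))
      ; first-on = A-hit ; last-on = B-hit
      ; inner = λ z∈ on → [ (λ z∈A → inj₁ (A-only (∈ᵛ-rev⁻ A z∈A) on))
                          , (λ z∈ → [ (λ z∈R → R-on z∈R on) , (λ z∈B → inj₂ (B-only z∈B on)) ] (∈ᵛ-⁀⁻ R z∈)) ]
                          (∈ᵛ-⁀⁻ (rev A) z∈)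
      ; avoids = λ h∈ → [ tail-avoids A A! A-only ∘ ∈ᵉ-rev⁻ A
                        , (λ h∈ → [ R-avoids , tail-avoids B B! B-only ] (∈ᵉ-⁀⁻ R h∈)) ]
                        (∈ᵉ-⁀⁻ (rev A) h∈) }
    , ∈ᵉ-⁀ʳ (rev A) ∘ ∈ᵉ-⁀ˡ R
    where
    open Linking L
    open FirstHit (firstHit (_∈? verts C) left c-on)
      renaming (walk to A; simple to A!; hit to A-hit; only to A-only; verts⊆ to A⊆)
    open FirstHit (firstHit (_∈? verts C) right d-on)
      renaming (walk to B; simple to B!; hit to B-hit; only to B-only; verts⊆ to B⊆)
    disj : ∀ {z} → z ∈ᵛ A → ¬ z ∈ᵛ B
    disj z∈A z∈B = disjoint (A⊆ z∈A) (B⊆ z∈B)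
    R∩B : Meet R B (_≡ q)
    R∩B z∈R z∈B with R-inner z∈R
    ... | inj₁ refl        = ⊥-elim (disj (first∈ A) z∈B)
    ... | inj₂ (inj₁ z≡q)  = z≡q
    ... | inj₂ (inj₂ ¬att) = ⊥-elim (¬att (rightAttached (B⊆ z∈B)))
    A∩RB : Meet (rev A) (R ⁀ B) (_≡ p)
    A∩RB z∈A z∈ with ∈ᵛ-⁀⁻ R z∈
    ... | inj₂ z∈B = ⊥-elim (disj (∈ᵛ-rev⁻ A z∈A) z∈B)
    ... | inj₁ z∈R with R-inner z∈R
    ...   | inj₁ z≡p         = z≡p
    ...   | inj₂ (inj₁ refl) = ⊥-elim (disj (∈ᵛ-rev⁻ A z∈A) (first∈ B))
    ...   | inj₂ (inj₂ ¬att) = ⊥-elim (¬att (leftAttached (A⊆ (∈ᵛ-rev⁻ A z∈A))))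
    R-on : ∀ {z} → z ∈ᵛ R → On z → z ≡ _ ⊎ z ≡ _
    R-on z∈R on with R-inner z∈R
    ... | inj₁ refl        = inj₁ (A-only (first∈ A) on)
    ... | inj₂ (inj₁ refl) = inj₂ (B-only (first∈ B) on)
    ... | inj₂ (inj₂ ¬att) = ⊥-elim (¬att (inj₁ on))
    -- An edge of a simple walk has an end other than the last vertex; for an edge of `C` this end
    -- would be on `C` too early.
    tail-avoids : ∀ {x y} (W : Walk x y) → Simple W → (∀ {z} → z ∈ᵛ W → On z → z ≡ y) →
      ∀ {h} → h ∈ᵉ W → h ∉ edges C
    tail-avoids W W! only h∈W h∈C with simple-edge-initial W W! h∈W
    ... | z , z∈ , i , z≢ = z≢ (only z∈ (on-edge h∈C i))

  Bare : E → Set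
  Bare h = h ∉ edges C × ∀ {a b} (P : Ear a b) → ¬ h ∈ᵉ path P

  unattached⇒bare : ∀ {h w} → ¬ Attached w → Incident h w → Bare h
  unattached⇒bare ¬att i = (λ h∈C → ¬att (inj₁ (on-edge h∈C i))) ,
    λ P h∈P → ¬att (inj₂ (_ , _ , P , edge-end∈ (path P) h∈P i))

  linked-bare : ∀ {h h′} → Star (Linked Attached) h h′ → Bare h → Bare h′
  linked-bare ε                          bare = bare
  linked-bare ((w , ¬att , _ , i) ◅ rest) _   = linked-bare rest (unattached⇒bare ¬att i)

  -- The linking vertices become the inner vertices of the walk. It may repeat vertices; loop
  -- erasure comes later.
  linked-walk : ∀ {h h′ p q} → Star (Linked Attached) h h′ → Bare h → Incident h p → Incident h′ q → p ≢ q →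
    ∃ λ (R : Walk p q) → (∀ {z} → z ∈ᵛ R → z ≡ p ⊎ z ≡ q ⊎ ¬ Attached z) × (∀ {g} → g ∈ᵉ R → Bare g)
  linked-walk ε bare i i′ p≢q = edge (incident-both i i′ p≢q) ,
    (λ { (here eq) → inj₁ eq ; (there (here eq)) → inj₂ (inj₁ eq) }) , λ { (here refl) → bare }
  linked-walk {h} {p = p} {q} ((w , ¬att , iw , iw′) ◅ rest) bare i i′ p≢q with p ≟ w | w ≟ q
  ... | yes refl | _ = linked-walk rest (unattached⇒bare ¬att iw′) iw′ i′ p≢q
  ... | no p≢w | yes refl = edge (incident-both i iw p≢w) ,
    (λ { (here eq) → inj₁ eq ; (there (here eq)) → inj₂ (inj₁ eq) }) , λ { (here refl) → bare }
  ... | no p≢w | no w≢q with linked-walk rest (unattached⇒bare ¬att iw′) iw′ i′ w≢q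
  ... | R , R-inner , R-bare = step h (incident-both i iw p≢w) R ,
    (λ { (here eq) → inj₁ eq
       ; (there z∈) → [ (λ { refl → inj₂ (inj₂ ¬att) }) , inj₂ ] (R-inner z∈) }) ,
    λ { (here refl) → bare ; (there g∈) → R-bare g∈ }

  -- Two distinct attached vertices of the class would be joined by a path of bare edges, and
  -- `close-ear` would extend this path to an ear containing them.
  bare-boundary : ∀ {g h h′ p q} → Bare g → Star (Linked Attached) g h → Star (Linked Attached) g h′ →
    Incident h p → Incident h′ q → Attached p → Attached q → ¬ p ≢ q
  bare-boundary {p = p} {q} bare gh gh′ ip iq p-att q-att p≢q
    with linked-walk (linked-sym gh ◅◅ gh′) (linked-bare gh bare) ip iq p≢q
  ... | R₀ , R-inner , R-bare with firstHit (_≟ q) R₀ refl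
  ... | record { walk = stop ; hit = eq } = p≢q eq
  ... | record { walk = R@(step h _ _) ; simple = R! ; hit = refl ; verts⊆ = v⊆ ; edges⊆ = e⊆ }
    with close-ear (linking p-att q-att p≢q) R R! (R-inner ∘ v⊆) (proj₁ ∘ R-bare ∘ e⊆)
  ... | _ , _ , P , R⊆P = proj₂ (R-bare (e⊆ (here refl))) P (R⊆P (here refl))

  -- A class of bare edges would be cut off by a single vertex.
  edge-on-ear : IsNonseparable (whole G) → ∀ {e} → e ∈ edges C → ∀ {g} → g ∉ edges C →
    ¬ ¬ (∃₂ λ a b → ∃ λ (P : Ear a b) → g ∈ᵉ path P)
  edge-on-ear (_ , (_ , conn) , no-cutpoint) {e} e∈ {g} g∉ not-on-ear =
    comprehension (Star (Linked Attached) g) λ (Y , Y-spec) →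
    comprehension (λ v → ∃ λ h → h ∈ Y × Incident h v) λ (VK , VK-spec) →
    comprehension (λ v → ∃ λ h → h ∉ Y × Incident h v) λ (VL , VL-spec) →
    let
      bare : Bare g
      bare = g∉ , λ P g∈ → not-on-ear (_ , _ , P , g∈)
      e∉Y : e ∉ Y
      e∉Y e∈Y = proj₁ (linked-bare (proj₁ (Y-spec e) e∈Y) bare) e∈
      g∈Y : g ∈ Y
      g∈Y = proj₂ (Y-spec g) ε
      -- If `w` were unattached, it would link `h` to `h′` and put `h′` into `Y`.
      boundary-attached : ∀ {w} → w ∈ VK → w ∈ VL → ¬ ¬ Attached w
      boundary-attached {w} w∈K w∈L ¬att =
        let h , h∈ , i = proj₁ (VK-spec w) w∈K ; h′ , h′∉ , i′ = proj₁ (VL-spec w) w∈L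
        in h′∉ (proj₂ (Y-spec h′) (proj₁ (Y-spec h) h∈ ◅◅ ((w , ¬att , i , i′) ◅ ε)))
      boundary-unique : ∀ {p q} → p ∈ VK → p ∈ VL → q ∈ VK → q ∈ VL → p ≡ q
      boundary-unique {p} {q} p∈K p∈L q∈K q∈L = decidable-stable (p ≟ q) λ p≢q →
        boundary-attached p∈K p∈L λ p-att → boundary-attached q∈K q∈L λ q-att →
        let h , h∈ , i = proj₁ (VK-spec p) p∈K ; h′ , h′∈ , i′ = proj₁ (VK-spec q) q∈K
        in bare-boundary bare (proj₁ (Y-spec h) h∈) (proj₁ (Y-spec h′) h′∈) i i′ p-att q-att p≢q
      reach : ∀ {x y} → Star (Adjacent (whole G)) x y → x ∈ VK → y ∈ VL → ∃ λ w → w ∈ VK × w ∈ VL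
      reach = cross Y VK-spec VL-spec
      -- A walk from an end of `g` to an end of `e` has to leave the class somewhere; the vertex
      -- where it does is the cutpoint.
      v , v∈K , v∈L = reach (conn (end₁ G g) (end₁ G e) ∈⊤ ∈⊤)
        (proj₂ (VK-spec _) (g , g∈Y , inj₁ refl)) (proj₂ (VL-spec _) (e , e∉Y , inj₁ refl))
    in no-cutpoint (v , piece VK Y , piece VL (∁ Y)
      , (λ h h∈ → proj₂ (VK-spec _) (h , h∈ , inj₁ refl) , proj₂ (VK-spec _) (h , h∈ , inj₂ refl))
      , (λ h h∈ → proj₂ (VL-spec _) (h , x∈∁p⇒x∉p h∈ , inj₁ refl) , proj₂ (VL-spec _) (h , x∈∁p⇒x∉p h∈ , inj₂ refl))
      , (g , g∈Y) , (e , x∉p⇒x∈∁p e∉Y)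
      , ⊆-antisym (λ _ → ∈⊤) (λ {x} _ → x∈p∪q⁺ (cover Y VK-spec VL-spec (incident-edge x)))
      , p∪∁p≡⊤ Y
      , ⊆-antisym (λ {x} x∈ → let x∈K , x∈L = x∈p∩q⁻ VK VL x∈ in
                      subst (_∈ ⁅ v ⁆) (boundary-unique v∈K v∈L x∈K x∈L) (x∈⁅x⁆ v))
                   (λ {x} x∈ → subst (_∈ VK ∩ VL) (sym (x∈⁅y⁆⇒x≡y v x∈)) (x∈p∩q⁺ (v∈K , v∈L)))
      , ⊆-antisym (λ x∈ → let x∈Y , x∈∁Y = x∈p∩q⁻ Y (∁ Y) x∈ in ⊥-elim (x∈∁p⇒x∉p x∈∁Y x∈Y)) (⊥-elim ∘ ∉⊥))
    where
    Spec : Subset _ → (V → Set) → Set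
    Spec S P = ∀ v → (v ∈ S → P v) × (P v → v ∈ S)
    cross : ∀ Y {VK VL} → Spec VK (λ v → ∃ λ h → h ∈ Y × Incident h v) →
      Spec VL (λ v → ∃ λ h → h ∉ Y × Incident h v) →
      ∀ {x y} → Star (Adjacent (whole G)) x y → x ∈ VK → y ∈ VL → ∃ λ w → w ∈ VK × w ∈ VL
    cross Y VK-spec VL-spec ε x∈K x∈L = _ , x∈K , x∈L
    cross Y VK-spec VL-spec ((h , _ , j) ◅ rest) x∈K y∈L with h ∈? Y
    ... | yes h∈ = cross Y VK-spec VL-spec rest (proj₂ (VK-spec _) (h , h∈ , joins-incidentʳ j)) y∈L
    ... | no h∉  = _ , x∈K , proj₂ (VL-spec _) (h , h∉ , joins-incidentˡ j)
    cover : ∀ Y {VK VL} → Spec VK (λ v → ∃ λ h → h ∈ Y × Incident h v) →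
      Spec VL (λ v → ∃ λ h → h ∉ Y × Incident h v) → ∀ {x} → ∃ (λ h → Incident h x) → x ∈ VK ⊎ x ∈ VL
    cover Y VK-spec VL-spec (h , i) with h ∈? Y
    ... | yes h∈ = inj₁ (proj₂ (VK-spec _) (h , h∈ , i))
    ... | no h∉  = inj₂ (proj₂ (VL-spec _) (h , h∉ , i))
    incident-edge : ∀ x → ∃ λ h → Incident h x
    incident-edge x with x ≟ end₁ G e
    ... | yes refl = e , inj₁ refl
    ... | no x≢ with conn x (end₁ G e) ∈⊤ ∈⊤
    ...   | ε = ⊥-elim (x≢ refl)
    ...   | (h , _ , j) ◅ _ = h , joins-incidentˡ j

-- Sign arithmetic.

≢+⇒≡- : ∀ {s} → s ≢ Sign.+ → s ≡ Sign.-
≢+⇒≡- {Sign.+} s≢ = ⊥-elim (s≢ refl)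
≢+⇒≡- {Sign.-} _  = refl

*-telescope : ∀ p q r → (p * q) * (q * r) ≡ p * r
*-telescope Sign.+ Sign.+ r = refl
*-telescope Sign.+ Sign.- Sign.+ = refl
*-telescope Sign.+ Sign.- Sign.- = refl
*-telescope Sign.- Sign.+ r = refl
*-telescope Sign.- Sign.- r = refl

*≡+⇒≡ : ∀ {s t} → s * t ≡ Sign.+ → s ≡ t
*≡+⇒≡ {Sign.+} {Sign.+} _ = refl
*≡+⇒≡ {Sign.-} {Sign.-} _ = refl

*≡-⇒≡opposite : ∀ {s t} → s * t ≡ Sign.- → s ≡ opposite t
*≡-⇒≡opposite {Sign.+} {Sign.-} _ = refl
*≡-⇒≡opposite {Sign.-} {Sign.+} _ = refl

-- The sign around two joined ears: each potential value occurs twice and the two factors `opposite`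
-- cancel.
alternating : ∀ a b c d → opposite (a * b) * ((b * c) * (opposite (c * d) * (d * a))) ≡ Sign.+
alternating Sign.+ Sign.+ Sign.+ Sign.+ = refl
alternating Sign.+ Sign.+ Sign.+ Sign.- = refl
alternating Sign.+ Sign.+ Sign.- Sign.+ = refl
alternating Sign.+ Sign.+ Sign.- Sign.- = refl
alternating Sign.+ Sign.- Sign.+ Sign.+ = refl
alternating Sign.+ Sign.- Sign.+ Sign.- = refl
alternating Sign.+ Sign.- Sign.- Sign.+ = refl
alternating Sign.+ Sign.- Sign.- Sign.- = refl
alternating Sign.- Sign.+ Sign.+ Sign.+ = refl
alternating Sign.- Sign.+ Sign.+ Sign.- = refl
alternating Sign.- Sign.+ Sign.- Sign.+ = refl
alternating Sign.- Sign.+ Sign.- Sign.- = refl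
alternating Sign.- Sign.- Sign.+ Sign.+ = refl
alternating Sign.- Sign.- Sign.+ Sign.- = refl
alternating Sign.- Sign.- Sign.- Sign.+ = refl
alternating Sign.- Sign.- Sign.- Sign.- = refl

-- Signs of walks, switching, and gluing two paths to a circle.

module Signs (S : SignedGraph) where

  private G = graph S

  open Walks G
  open SubsetSum *-commutativeMonoid using () renaming (∑ˡ to ∏ˡ; ∑∈-fromList to ∏∈-fromList)

  walkSign : ∀ {a b} → Walk a b → Sign
  walkSign W = ∏ˡ (σ S) (edgeList W)

  walkSign-⁀ : ∀ {a b c} (A : Walk a b) (B : Walk b c) → walkSign (A ⁀ B) ≡ walkSign A * walkSign B
  walkSign-⁀ stop         B = refl
  walkSign-⁀ (step h j A) B = trans (cong (σ S h *_) (walkSign-⁀ A B)) (sym (*-assoc (σ S h) _ _))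

  -- `τ` is a switching function, and a balanced edge is one that switching makes positive.
  Balanced : (V → Sign) → E → Set
  Balanced τ h = ∀ {x y} → Joins G h x y → σ S h ≡ τ x * τ y

  balanced-walk : ∀ τ {a b} (W : Walk a b) → (∀ {h} → h ∈ᵉ W → Balanced τ h) → walkSign W ≡ τ a * τ b
  balanced-walk τ {a} stop bal = sym (s*s≡+ (τ a))
  balanced-walk τ (step h j W) bal =
    trans (cong₂ _*_ (bal (here refl) j) (balanced-walk τ W (bal ∘ there))) (*-telescope (τ _) (τ _) (τ _))

  -- The value at each new first vertex is chosen to fit its edge. Simplicity guarantees that this
  -- vertex carries no earlier constraint.
  potential : ∀ {a b} (W : Walk a b) → Simple W → ∃ λ τ → ∀ {h} → h ∈ᵉ W → Balanced τ h
  potential stop _ = (λ _ → Sign.+) , λ ()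
  potential (step {a} {b} h j W) W! with unique-∷⁻ W!
  ... | a∉ , W′! with potential W W′!
  ... | τ′ , bal′ = τ , bal
    where
    τ : V → Sign
    τ z with z ≟ a
    ... | yes _ = σ S h * τ′ b
    ... | no _  = τ′ z
    τ-a : τ a ≡ σ S h * τ′ b
    τ-a with a ≟ a
    ... | yes _  = refl
    ... | no a≢a = ⊥-elim (a≢a refl)
    τ-∈ : ∀ {z} → z ∈ᵛ W → τ z ≡ τ′ z
    τ-∈ {z} z∈ with z ≟ a
    ... | yes refl = ⊥-elim (a∉ z∈)
    ... | no _     = refl
    τ-h : σ S h ≡ τ a * τ b
    τ-h rewrite τ-a | τ-∈ (first∈ W) =
      sym (trans (*-assoc (σ S h) _ _) (trans (cong (σ S h *_) (s*s≡+ (τ′ b))) (*-identityʳ _)))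
    bal : ∀ {g} → g ∈ᵉ step h j W → Balanced τ g
    bal (there g∈) jg = trans (bal′ g∈ jg) (sym (cong₂ _*_
      (τ-∈ (edge-end∈ W g∈ (joins-incidentˡ jg))) (τ-∈ (edge-end∈ W g∈ (joins-incidentʳ jg)))))
    bal (here refl) jg with incident-end jg (joins-incidentˡ j) | incident-end jg (joins-incidentʳ j)
    ... | inj₁ refl | inj₂ refl = τ-h
    ... | inj₂ refl | inj₁ refl = trans τ-h (*-comm (τ a) (τ b))
    ... | inj₁ refl | inj₁ refl = ⊥-elim (a∉ (first∈ W))
    ... | inj₂ refl | inj₂ refl = ⊥-elim (a∉ (first∈ W))

  record Glued {a b} (P : Walk a b) (R : Walk b a) : Set where
    field
      circle   : Piece G
      isCircle : IsCircle circle
      sign≡    : sign S circle ≡ walkSign P * walkSign R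
      edges⁺   : ∀ {h} → h ∈ᵉ P ⊎ h ∈ᵉ R → h ∈ edges circle
      edges⁻   : ∀ {h} → h ∈ edges circle → h ∈ᵉ P ⊎ h ∈ᵉ R

  -- Edges need their own disjointness condition: two walks along the same single edge meet only at
  -- their ends. The first edge of `P` serves as the closing edge of `closure`.
  glue : ∀ {a b} (P : Walk a b) (R : Walk b a) → a ≢ b → Simple P → Simple R →
    Meet P R (λ z → z ≡ a ⊎ z ≡ b) → (∀ {h} → h ∈ᵉ P → ¬ h ∈ᵉ R) → Glued P R
  glue stop R a≢b = ⊥-elim (a≢b refl)
  glue {a} {b} (step h j P) R a≢b P! R! meet disj with unique-∷⁻ P!
  ... | a∉ , P′! = record
    { circle = closure (P ⁀ R) h
    ; isCircle = closure-isCircle (P ⁀ R) j PR! h∉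
    ; sign≡ = trans (∏∈-fromList (σ S) (unique-∷ h∉ (simple⇒edges-unique (P ⁀ R) PR!)))
        (trans (cong (σ S h *_) (walkSign-⁀ P R)) (sym (*-assoc (σ S h) _ _)))
    ; edges⁺ = λ { (inj₁ (here p)) → ∈-fromList⁺ {xs = h ∷ edgeList (P ⁀ R)} (here p)
                 ; (inj₁ (there h∈)) → ∈-fromList⁺ (there (∈ᵉ-⁀ˡ P h∈))
                 ; (inj₂ h∈) → ∈-fromList⁺ (there (∈ᵉ-⁀ʳ P h∈)) }
    ; edges⁻ = back ∘ ∈-fromList⁻ (h ∷ edgeList (P ⁀ R)) }
    where
    PR! : Simple (P ⁀ R)
    PR! = ⁀-simple⁺ P P′! R! λ z∈P z∈R →
      [ (λ { refl → ⊥-elim (a∉ z∈P) }) , id ]′ (meet (there z∈P) z∈R)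
    h∉ : ¬ h ∈ᵉ P ⁀ R
    h∉ h∈ with ∈ᵉ-⁀⁻ P h∈
    ... | inj₁ h∈P = a∉ (edge-end∈ P h∈P (joins-incidentˡ j))
    ... | inj₂ h∈R = disj (here refl) h∈R
    back : ∀ {g} → g ∈ˡ h ∷ edgeList (P ⁀ R) → g ∈ᵉ step h j P ⊎ g ∈ᵉ R
    back (here p)   = inj₁ (here p)
    back (there g∈) = Sum.map₁ there (∈ᵉ-⁀⁻ P g∈)

-- Arcs of `C` and disjoint pairs of arcs.

module Arcs (G : Graph) (loopless : ∀ h → end₁ G h ≢ end₂ G h)
            (C : Piece G) (C-circle : IsCircle C)
            {e : Fin (size G)} (e∈ : e ∈ edges C) where

  open Walks G
  open Traversals G loopless
  open Ears G loopless C (proj₁ C-circle) using (On; on-edge)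

  u = end₁ G e
  v = end₂ G e

  traversal : Traversal C e u v
  traversal = circle-traversal {C} C-circle e∈ (inj₂ (refl , refl))

  open Traversal traversal renaming (path to L; simple to L!)

  Inside : ∀ {a b} → Walk a b → Set
  Inside W = ∀ {h} → h ∈ᵉ W → h ∈ edges C

  inside-on : ∀ {a b z} (W : Walk a b) → Inside W → On a → z ∈ᵛ W → On z
  inside-on stop         W⊆ on (here refl) = on
  inside-on (step h j W) W⊆ on (here refl) = on
  inside-on (step h j W) W⊆ on (there z∈)  =
    inside-on W (W⊆ ∘ there) (on-edge (W⊆ (here refl)) (joins-incidentʳ j)) z∈

  record Arcs (a b : V) : Set where
    field
      X Y     : Walk a b
      X!      : Simple X
      Y!      : Simple Y
      X⊆      : Inside X
      Y⊆      : Inside Y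
      meet    : Meet X Y (λ z → z ≡ a ⊎ z ≡ b)
      cover   : ∀ {z} → On z → z ∈ᵛ X ⊎ z ∈ᵛ Y
      through : e ∈ᵉ X ⊎ e ∈ᵉ Y

  flipArcs : ∀ {a b} → Arcs a b → Arcs b a
  flipArcs 𝒜 = record
    { X = rev X ; Y = rev Y ; X! = rev-simple X X! ; Y! = rev-simple Y Y!
    ; X⊆ = X⊆ ∘ ∈ᵉ-rev⁻ X ; Y⊆ = Y⊆ ∘ ∈ᵉ-rev⁻ Y
    ; meet = λ z∈X z∈Y → Sum.swap (meet (∈ᵛ-rev⁻ X z∈X) (∈ᵛ-rev⁻ Y z∈Y))
    ; cover = Sum.map (∈ᵛ-rev⁺ X) (∈ᵛ-rev⁺ Y) ∘ cover
    ; through = Sum.map (∈ᵉ-rev⁺ X) (∈ᵉ-rev⁺ Y) through }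
    where open Arcs 𝒜

  -- The complementary arc goes back from `a` to `u`, crosses `e`, and goes back from `v` to `b`;
  -- hence it is the one through `e`.
  segment-arcs : ∀ {a b} (A : Walk u a) (X : Walk a b) (B : Walk b v) → L ≡ A ⁀ X ⁀ B → a ≢ b → Arcs a b
  segment-arcs {a} {b} A X B eq a≢b = record
    { X = X ; Y = Y ; X! = X! ; Y! = Y!
    ; X⊆ = L⊆ ∘ ∈ᵉ-⁀ʳ A ∘ ∈ᵉ-⁀ˡ X
    ; Y⊆ = λ h∈ → [ L⊆ ∘ ∈ᵉ-⁀ˡ A ∘ ∈ᵉ-rev⁻ A
                  , (λ { (here refl) → e∈ ; (there h∈B) → L⊆ (∈ᵉ-⁀ʳ A (∈ᵉ-⁀ʳ X (∈ᵉ-rev⁻ B h∈B))) }) ]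
                  (∈ᵉ-⁀⁻ (rev A) h∈)
    ; meet = meet
    ; cover = cover
    ; through = inj₂ (∈ᵉ-⁀ʳ (rev A) (here refl)) }
    where
    L⊆ : ∀ {h} → h ∈ᵉ A ⁀ X ⁀ B → h ∈ edges C
    L⊆ h∈ = edges⊆ (subst (_ ∈ᵉ_) (sym eq) h∈)
    A-XB! = ⁀-simple⁻ A (subst Simple eq L!)
    X-B! = ⁀-simple⁻ X (proj₁ (proj₂ A-XB!))
    A! = proj₁ A-XB!
    X! = proj₁ X-B!
    B! = proj₁ (proj₂ X-B!)
    A∩XB : Meet A (X ⁀ B) (_≡ a)
    A∩XB = proj₂ (proj₂ A-XB!)
    X∩B : Meet X B (_≡ b)
    X∩B = proj₂ (proj₂ X-B!)
    A∩B : ∀ {z} → z ∈ᵛ A → ¬ z ∈ᵛ B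
    A∩B z∈A z∈B with A∩XB z∈A (∈ᵛ-⁀ʳ X z∈B)
    ... | refl = a≢b (X∩B (first∈ X) z∈B)
    eB : Walk u b
    eB = step e (inj₁ (refl , refl)) (rev B)
    Y = rev A ⁀ eB
    Y! : Simple Y
    Y! = ⁀-simple⁺ (rev A) (rev-simple A A!)
      (unique-∷ (A∩B (first∈ A) ∘ ∈ᵛ-rev⁻ B) (rev-simple B B!))
      λ { z∈A (here p) → p ; z∈A (there z∈B) → ⊥-elim (A∩B (∈ᵛ-rev⁻ A z∈A) (∈ᵛ-rev⁻ B z∈B)) }
    meet : Meet X Y (λ z → z ≡ a ⊎ z ≡ b)
    meet z∈X z∈Y with ∈ᵛ-⁀⁻ (rev A) z∈Y
    ... | inj₁ z∈A         = inj₁ (A∩XB (∈ᵛ-rev⁻ A z∈A) (∈ᵛ-⁀ˡ X z∈X))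
    ... | inj₂ (here refl) = inj₁ (A∩XB (first∈ A) (∈ᵛ-⁀ˡ X z∈X))
    ... | inj₂ (there z∈B) = inj₂ (X∩B z∈X (∈ᵛ-rev⁻ B z∈B))
    cover : ∀ {z} → On z → z ∈ᵛ X ⊎ z ∈ᵛ Y
    cover on with ∈ᵛ-⁀⁻ A (subst (_ ∈ᵛ_) eq (verts⊇ on))
    ... | inj₁ z∈A = inj₂ (∈ᵛ-⁀ˡ (rev A) (∈ᵛ-rev⁺ A z∈A))
    ... | inj₂ z∈ with ∈ᵛ-⁀⁻ X z∈
    ...   | inj₁ z∈X = inj₁ z∈X
    ...   | inj₂ z∈B = inj₂ (∈ᵛ-⁀ʳ (rev A) (there (∈ᵛ-rev⁺ B z∈B)))

  arcs : ∀ {a b} → On a → On b → a ≢ b → Arcs a b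
  arcs {a} {b} a-on b-on a≢b with split L (verts⊇ a-on)
  ... | A , B , eq with ∈ᵛ-⁀⁻ A (subst (b ∈ᵛ_) eq (verts⊇ b-on))
  ... | inj₂ b∈B with split B b∈B
  ...   | B₁ , B₂ , refl = segment-arcs A B₁ B₂ eq a≢b
  arcs {a} {b} a-on b-on a≢b | A , B , eq | inj₁ b∈A with split A b∈A
  ...   | A₁ , A₂ , refl = flipArcs (segment-arcs A₁ A₂ B (trans eq (⁀-assoc A₁ A₂ B)) (a≢b ∘ sym))

  record Pairing (a b c d : V) : Set where
    field
      A : Walk a c
      B : Walk b d
      A! : Simple A
      B! : Simple B
      A⊆ : Inside A
      B⊆ : Inside B
      disjoint : ∀ {z} → z ∈ᵛ A → ¬ z ∈ᵛ B

  -- Whichever of `c` and `d` comes first on the way from `a` to `b` is paired with `a`, the other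
  -- with `b`.
  pair-same : ∀ {a b c d} (X : Walk a b) → Simple X → Inside X → c ∈ᵛ X → d ∈ᵛ X → c ≢ d →
    Pairing a b c d ⊎ Pairing a b d c
  pair-same {c = c} {d} X X! X⊆ c∈ d∈ c≢d with split X c∈
  ... | X₁ , X₂ , refl with ⁀-simple⁻ X₁ X! | ∈ᵛ-⁀⁻ X₁ d∈
  ... | X₁! , X₂! , meet | inj₂ d∈X₂ with split X₂ d∈X₂
  ...   | Y₁ , Y₂ , refl with ⁀-simple⁻ Y₁ X₂!
  ...   | _ , Y₂! , meet′ = inj₁ record
    { A = X₁ ; B = rev Y₂ ; A! = X₁! ; B! = rev-simple Y₂ Y₂!
    ; A⊆ = X⊆ ∘ ∈ᵉ-⁀ˡ X₁ ; B⊆ = X⊆ ∘ ∈ᵉ-⁀ʳ X₁ ∘ ∈ᵉ-⁀ʳ Y₁ ∘ ∈ᵉ-rev⁻ Y₂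
    ; disjoint = λ z∈X₁ z∈Y₂ → disj z∈X₁ (∈ᵛ-rev⁻ Y₂ z∈Y₂) }
    where
    disj : ∀ {z} → z ∈ᵛ X₁ → ¬ z ∈ᵛ Y₂
    disj z∈X₁ z∈Y₂ with meet z∈X₁ (∈ᵛ-⁀ʳ Y₁ z∈Y₂)
    ... | refl = c≢d (meet′ (first∈ Y₁) z∈Y₂)
  pair-same {c = c} {d} X X! X⊆ c∈ d∈ c≢d | X₁ , X₂ , refl | X₁! , X₂! , meet | inj₁ d∈X₁ with split X₁ d∈X₁
  ...   | Y₁ , Y₂ , refl with ⁀-simple⁻ Y₁ X₁!
  ...   | Y₁! , _ , meet′ = inj₂ record
    { A = Y₁ ; B = rev X₂ ; A! = Y₁! ; B! = rev-simple X₂ X₂!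
    ; A⊆ = X⊆ ∘ ∈ᵉ-⁀ˡ (Y₁ ⁀ Y₂) ∘ ∈ᵉ-⁀ˡ Y₁ ; B⊆ = X⊆ ∘ ∈ᵉ-⁀ʳ (Y₁ ⁀ Y₂) ∘ ∈ᵉ-rev⁻ X₂
    ; disjoint = λ z∈Y₁ z∈X₂ → disj z∈Y₁ (∈ᵛ-rev⁻ X₂ z∈X₂) }
    where
    disj : ∀ {z} → z ∈ᵛ Y₁ → ¬ z ∈ᵛ X₂
    disj z∈Y₁ z∈X₂ with meet (∈ᵛ-⁀ˡ Y₁ z∈Y₁) z∈X₂
    ... | refl = c≢d (meet′ z∈Y₁ (last∈ Y₂))

  pair-opposite : ∀ {a b c d} (X Y : Walk a b) → Simple X → Simple Y → Inside X → Inside Y →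
    Meet X Y (λ z → z ≡ a ⊎ z ≡ b) → c ∈ᵛ X → d ∈ᵛ Y → c ≢ b → d ≢ a → Pairing a b c d
  pair-opposite {a} {b} X Y X! Y! X⊆ Y⊆ meet c∈ d∈ c≢b d≢a with split X c∈ | split Y d∈
  ... | X₁ , X₂ , refl | Y₁ , Y₂ , refl with ⁀-simple⁻ X₁ X! | ⁀-simple⁻ Y₁ Y!
  ... | X₁! , _ , meetX | _ , Y₂! , meetY = record
    { A = X₁ ; B = rev Y₂ ; A! = X₁! ; B! = rev-simple Y₂ Y₂!
    ; A⊆ = X⊆ ∘ ∈ᵉ-⁀ˡ X₁ ; B⊆ = Y⊆ ∘ ∈ᵉ-⁀ʳ Y₁ ∘ ∈ᵉ-rev⁻ Y₂
    ; disjoint = λ z∈X₁ z∈Y₂ → disj z∈X₁ (∈ᵛ-rev⁻ Y₂ z∈Y₂) }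
    where
    disj : ∀ {z} → z ∈ᵛ X₁ → ¬ z ∈ᵛ Y₂
    disj z∈X₁ z∈Y₂ with meet (∈ᵛ-⁀ˡ X₁ z∈X₁) (∈ᵛ-⁀ʳ Y₁ z∈Y₂)
    ... | inj₁ refl = d≢a (sym (meetY (first∈ Y₁) z∈Y₂))
    ... | inj₂ refl = c≢b (sym (meetX z∈X₁ (last∈ X₂)))

  -- With `c` and `d` on different arcs, the first pairing fails only if `c ≡ b` or `d ≡ a`, where
  -- the two pieces could touch; in these cases the swapped pairing is safe.
  pair-mixed : ∀ {a b c d} (X Y : Walk a b) → Simple X → Simple Y → Inside X → Inside Y →
    Meet X Y (λ z → z ≡ a ⊎ z ≡ b) → c ∈ᵛ X → d ∈ᵛ Y → a ≢ b → c ≢ d →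
    Pairing a b c d ⊎ Pairing a b d c
  pair-mixed {a} {b} {c} {d} X Y X! Y! X⊆ Y⊆ meet c∈ d∈ a≢b c≢d with c ≟ b | d ≟ a
  ... | no c≢b | no d≢a = inj₁ (pair-opposite X Y X! Y! X⊆ Y⊆ meet c∈ d∈ c≢b d≢a)
  ... | yes refl | _ = inj₂ (pair-opposite Y X Y! X! Y⊆ X⊆ (λ y x → meet x y) d∈ c∈ (c≢d ∘ sym) (a≢b ∘ sym))
  ... | _ | yes refl = inj₂ (pair-opposite Y X Y! X! Y⊆ X⊆ (λ y x → meet x y) d∈ c∈ a≢b c≢d)

  pairing : ∀ {a b c d} → On a → On b → On c → On d → a ≢ b → c ≢ d →
    Pairing a b c d ⊎ Pairing a b d c
  pairing a-on b-on c-on d-on a≢b c≢d = choose (cover c-on) (cover d-on)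
    where
    open Arcs (arcs a-on b-on a≢b)
    choose : _ ∈ᵛ X ⊎ _ ∈ᵛ Y → _ ∈ᵛ X ⊎ _ ∈ᵛ Y → _
    choose (inj₁ c∈) (inj₁ d∈) = pair-same X X! X⊆ c∈ d∈ c≢d
    choose (inj₂ c∈) (inj₂ d∈) = pair-same Y Y! Y⊆ c∈ d∈ c≢d
    choose (inj₁ c∈) (inj₂ d∈) = pair-mixed X Y X! Y! X⊆ Y⊆ meet c∈ d∈ a≢b c≢d
    choose (inj₂ c∈) (inj₁ d∈) = pair-mixed Y X Y! X! Y⊆ X⊆ (λ y x → meet x y) c∈ d∈ a≢b c≢d

-- Signs of ears, and joining two ears to a positive circle.

module Batteries (S : SignedGraph) (loopless : ∀ h → end₁ (graph S) h ≢ end₂ (graph S) h)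
                 (C : Piece (graph S)) (C-circle : IsCircle C) (C-positive : sign S C ≡ Sign.+)
                 {e : Fin (size (graph S))} (e∈ : e ∈ edges C)
                 (only-C : ∀ C′ → IsPositiveCircle S C′ → e ∈ edges C′ → C′ ≡ C) where

  open Walks (graph S)
  open Signs S
  open Arcs (graph S) loopless C C-circle e∈
  open Ears (graph S) loopless C (proj₁ C-circle)
  open SubsetSum *-commutativeMonoid using () renaming (∑∈ to ∏∈; ∑∈-fromList to ∏∈-fromList)
  private module L = Traversals.Traversal traversal

  τ : V → Sign
  τ = proj₁ (potential L.path L.simple)

  -- `τ` fits the traversal by construction. It fits `e` as well because `C` is positive, so `e` has
  -- the same sign as the rest of `C`.
  C-balanced : ∀ {h} → h ∈ edges C → Balanced τ h
  C-balanced h∈ with L.edges⊇ h∈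
  ... | there h∈L = proj₂ (potential L.path L.simple) h∈L
  ... | here refl = λ j → trans e-sign (τ-ends j)
    where
    e-sign : σ S e ≡ τ u * τ v
    e-sign = trans (*≡+⇒≡ (trans (sym (trans
        (cong (∏∈ (σ S)) (⊆-antisym (∈-fromList⁺ ∘ L.edges⊇)
          λ g∈ → back (∈-fromList⁻ (e ∷ edgeList L.path) g∈)))
        (∏∈-fromList (σ S) (unique-∷ L.omits (simple⇒edges-unique L.path L.simple))))) C-positive))
      (balanced-walk τ L.path (proj₂ (potential L.path L.simple)))
      where
      back : ∀ {g} → g ∈ˡ e ∷ edgeList L.path → g ∈ edges C
      back (here refl) = e∈
      back (there g∈)  = L.edges⊆ g∈
    τ-ends : ∀ {x y} → Joins (graph S) e x y → τ u * τ v ≡ τ x * τ y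
    τ-ends (inj₁ (refl , refl)) = refl
    τ-ends (inj₂ (refl , refl)) = *-comm (τ u) (τ v)

  inside-sign : ∀ {a b} (W : Walk a b) → Inside W → walkSign W ≡ τ a * τ b
  inside-sign W W⊆ = balanced-walk τ W (C-balanced ∘ W⊆)

  -- `opposite (τ a * τ b)` expresses, in the original signs, that the ear is negative after
  -- switching.
  ear-sign-via : ∀ {a b} (P : Ear a b) (R : Walk b a) → Simple R → Inside R → e ∈ᵉ R →
    walkSign (path P) ≡ opposite (τ a * τ b)
  ear-sign-via {a} {b} P R R! R⊆ e∈R =
    trans (*≡-⇒≡opposite (trans (sym sign≡) (≢+⇒≡- not+)))
      (cong opposite (trans (inside-sign R R⊆) (*-comm (τ b) (τ a))))
    where
    open Glued (glue (path P) R (ends≢ P) (simple P) R!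
      (λ z∈P z∈R → inner P z∈P (inside-on R R⊆ (last-on P) z∈R)) (λ h∈P h∈R → avoids P h∈P (R⊆ h∈R)))
    not+ : sign S circle ≢ Sign.+
    not+ positive = let h , h∈P , _ = vertex-edge (path P) (ends≢ P) (first∈ (path P)) in avoids P h∈P
      (subst (λ Z → h ∈ edges Z) (only-C circle (isCircle , positive) (edges⁺ (inj₂ e∈R))) (edges⁺ (inj₁ h∈P)))

  ear-sign : ∀ {a b} (P : Ear a b) → walkSign (path P) ≡ opposite (τ a * τ b)
  ear-sign P with arcs (first-on P) (last-on P) (ends≢ P)
  ... | record { X = X ; X! = X! ; X⊆ = X⊆ ; through = inj₁ e∈X } =
    ear-sign-via P (rev X) (rev-simple X X!) (X⊆ ∘ ∈ᵉ-rev⁻ X) (∈ᵉ-rev⁺ X e∈X)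
  ... | record { Y = Y ; Y! = Y! ; Y⊆ = Y⊆ ; through = inj₂ e∈Y } =
    ear-sign-via P (rev Y) (rev-simple Y Y!) (Y⊆ ∘ ∈ᵉ-rev⁻ Y) (∈ᵉ-rev⁺ Y e∈Y)

  -- `⊆union` is what later tells two such circles apart: an edge off `C` and on neither ear is not
  -- on the circle.
  record JoinedEars {a b c d} (P : Ear a b) (Q : Ear c d) : Set where
    field
      circle   : Piece (graph S)
      positive : IsPositiveCircle S circle
      left⊆    : ∀ {h} → h ∈ᵉ path P → h ∈ edges circle
      right⊆   : ∀ {h} → h ∈ᵉ path Q → h ∈ edges circle
      ⊆union   : ∀ {h} → h ∈ edges circle → h ∈ᵉ path P ⊎ h ∈ᵉ path Q ⊎ h ∈ edges C

  -- The ears may share end vertices; an arc between coinciding ends is then a single vertex.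
  join-paired : ∀ {a b c d} (P : Ear a b) (Q : Ear c d) → Pairing a b d c →
    Meet (path P) (path Q) On → (∀ {h} → h ∈ᵉ path P → ¬ h ∈ᵉ path Q) → JoinedEars P Q
  join-paired {a} {b} {c} {d} P Q pairing PQ PQ-edges = record
    { circle = circle
    ; positive = isCircle , trans sign≡ (trans (cong₂ _*_ (ear-sign P) R-sign) (alternating (τ a) (τ b) (τ c) (τ d)))
    ; left⊆ = edges⁺ ∘ inj₁
    ; right⊆ = edges⁺ ∘ inj₂ ∘ ∈ᵉ-⁀ʳ B ∘ ∈ᵉ-⁀ˡ (path Q)
    ; ⊆union = λ h∈ → Sum.map₂ R-edge (edges⁻ h∈) }
    where
    open Pairing pairing
    -- The return route: an arc from `b` to `c`, the second ear to `d`, and an arc back to `a`.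
    R : Walk b a
    R = B ⁀ path Q ⁀ rev A
    A-on : ∀ {z} → z ∈ᵛ A → On z
    A-on = inside-on A A⊆ (first-on P)
    B-on : ∀ {z} → z ∈ᵛ B → On z
    B-on = inside-on B B⊆ (last-on P)
    QA! : Simple (path Q ⁀ rev A)
    QA! = ⁀-simple⁺ (path Q) (simple Q) (rev-simple A A!) QA-meet
      where
      QA-meet : Meet (path Q) (rev A) (_≡ d)
      QA-meet z∈Q z∈A with inner Q z∈Q (A-on (∈ᵛ-rev⁻ A z∈A))
      ... | inj₁ refl = ⊥-elim (disjoint (∈ᵛ-rev⁻ A z∈A) (last∈ B))
      ... | inj₂ z≡d  = z≡d
    R! : Simple R
    R! = ⁀-simple⁺ B B! QA! R-meet
      where
      R-meet : Meet B (path Q ⁀ rev A) (_≡ c)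
      R-meet z∈B z∈ with ∈ᵛ-⁀⁻ (path Q) z∈
      ... | inj₂ z∈A = ⊥-elim (disjoint (∈ᵛ-rev⁻ A z∈A) z∈B)
      ... | inj₁ z∈Q with inner Q z∈Q (B-on z∈B)
      ...   | inj₁ z≡c  = z≡c
      ...   | inj₂ refl = ⊥-elim (disjoint (last∈ A) z∈B)
    R-edge : ∀ {h} → h ∈ᵉ R → h ∈ᵉ path Q ⊎ h ∈ edges C
    R-edge h∈ with ∈ᵉ-⁀⁻ B h∈
    ... | inj₁ h∈B = inj₂ (B⊆ h∈B)
    ... | inj₂ h∈QA = Sum.map₂ (A⊆ ∘ ∈ᵉ-rev⁻ A) (∈ᵉ-⁀⁻ (path Q) h∈QA)
    R-sign : walkSign R ≡ (τ b * τ c) * (opposite (τ c * τ d) * (τ d * τ a))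
    R-sign = trans (walkSign-⁀ B _) (cong₂ _*_ (inside-sign B B⊆)
      (trans (walkSign-⁀ (path Q) _) (cong₂ _*_ (ear-sign Q) (inside-sign (rev A) (A⊆ ∘ ∈ᵉ-rev⁻ A)))))
    P∩R : Meet (path P) R (λ z → z ≡ a ⊎ z ≡ b)
    P∩R z∈P z∈R = inner P z∈P (on (∈ᵛ-⁀⁻ B z∈R))
      where
      on : _ ∈ᵛ B ⊎ _ ∈ᵛ path Q ⁀ rev A → On _
      on (inj₁ z∈B) = B-on z∈B
      on (inj₂ z∈) with ∈ᵛ-⁀⁻ (path Q) z∈
      ... | inj₁ z∈Q = PQ z∈P z∈Q
      ... | inj₂ z∈A = A-on (∈ᵛ-rev⁻ A z∈A)
    open Glued (glue (path P) R (ends≢ P) (simple P) R! P∩R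
      λ h∈P h∈R → [ PQ-edges h∈P , avoids P h∈P ] (R-edge h∈R))

  join-ears : ∀ {a b c d} (P : Ear a b) (Q : Ear c d) →
    Meet (path P) (path Q) On → (∀ {h} → h ∈ᵉ path P → ¬ h ∈ᵉ path Q) → JoinedEars P Q
  join-ears P Q PQ PQ-edges with pairing (first-on P) (last-on P) (first-on Q) (last-on Q) (ends≢ P) (ends≢ Q)
  ... | inj₂ p = join-paired P Q p PQ PQ-edges
  -- This pairing fits `Q` traversed backwards.
  ... | inj₁ p = record
    { circle = circle ; positive = positive ; left⊆ = left⊆
    ; right⊆ = right⊆ ∘ ∈ᵉ-rev⁺ (path Q)
    ; ⊆union = λ h∈ → Sum.map₂ (Sum.map₁ (∈ᵉ-rev⁻ (path Q))) (⊆union h∈) }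
    where open JoinedEars (join-paired P (revEar Q) p (λ z∈P z∈Q → PQ z∈P (∈ᵛ-rev⁻ (path Q) z∈Q))
                                       (λ h∈P h∈Q → PQ-edges h∈P (∈ᵉ-rev⁻ (path Q) h∈Q)))

-- Bridges of `C` and linkage of edges off `C`.

∧-true⁻ : ∀ {x y} → x ∧ y ≡ true → x ≡ true × y ≡ true
∧-true⁻ {true} {true} _ = refl , refl

∨-true⁻ : ∀ {x y} → x ∨ y ≡ true → x ≡ true ⊎ y ≡ true
∨-true⁻ {true}  _ = inj₁ refl
∨-true⁻ {false} p = inj₂ p

∈-edgesBetween⁻ : ∀ G X Y {h} → h ∈ edgesBetween G X Y →
  (end₁ G h ∈ X × end₂ G h ∈ Y) ⊎ (end₁ G h ∈ Y × end₂ G h ∈ X)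
∈-edgesBetween⁻ G X Y h∈ = Sum.map both both (∨-true⁻ (∈-tabulate⁻ _ h∈))
  where
  both : ∀ {S T x y} → lookup S x ∧ lookup T y ≡ true → x ∈ S × y ∈ T
  both eq = let p , q = ∧-true⁻ eq in lookup⇒[]= _ _ p , lookup⇒[]= _ _ q

∈-edgesBetween⁺ : ∀ G X Y {h x y} → Joins G h x y → x ∈ X → y ∈ Y → h ∈ edgesBetween G X Y
∈-edgesBetween⁺ G X Y (inj₁ (refl , refl)) x∈ y∈ =
  ∈-tabulate⁺ _ (cong₂ _∨_ (cong₂ _∧_ ([]=⇒lookup x∈) ([]=⇒lookup y∈)) refl)
∈-edgesBetween⁺ G X Y (inj₂ (refl , refl)) x∈ y∈ = ∈-tabulate⁺ _
  (trans (cong₂ _∨_ refl (cong₂ _∧_ ([]=⇒lookup y∈) ([]=⇒lookup x∈))) (∨-zeroʳ _))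

∈-delete⁺ : ∀ G X {h} → end₁ G h ∉ X → end₂ G h ∉ X → h ∈ edges (delete G X)
∈-delete⁺ G X h₁ h₂ = ∈-tabulate⁺ _ (cong₂ _∧_ ([]=⇒lookup (x∉p⇒x∈∁p h₁)) ([]=⇒lookup (x∉p⇒x∈∁p h₂)))

module Bridges (G : Graph) (C : Piece G) (C-sub : IsSubgraph C) where

  open Walks G
  open Linkage G

  private
    On : V → Set
    On z = z ∈ verts C

  adjacent-⊑ : ∀ {H K : Piece G} → edges H ⊆ edges K → ∀ {x y} → Star (Adjacent H) x y → Star (Adjacent K) x y
  adjacent-⊑ H⊆K = Star.map λ (h , h∈ , j) → h , H⊆K h∈ , j

  adjacents-sym : ∀ {H : Piece G} {x y} → Star (Adjacent H) x y → Star (Adjacent H) y x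
  adjacents-sym {H} = Star.reverse (adjacent-sym {H})

  infixr 6 _⊔_

  _⊔_ : Piece G → Piece G → Piece G
  H ⊔ K = piece (verts H ∪ verts K) (edges H ∪ edges K)

  ⊔-isSubgraph : ∀ {H K} → IsSubgraph H → IsSubgraph K → IsSubgraph (H ⊔ K)
  ⊔-isSubgraph {H} {K} H-sub K-sub h h∈ with x∈p∪q⁻ (edges H) (edges K) h∈
  ... | inj₁ h∈H = let p , q = H-sub h h∈H in x∈p∪q⁺ (inj₁ p) , x∈p∪q⁺ (inj₁ q)
  ... | inj₂ h∈K = let p , q = K-sub h h∈K in x∈p∪q⁺ (inj₂ p) , x∈p∪q⁺ (inj₂ q)

  ⊔-connected : ∀ {H K w} → w ∈ verts H → w ∈ verts K → Connected H → Connected K → Connected (H ⊔ K)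
  ⊔-connected {H} {K} {w} w∈H w∈K (_ , H-conn) (_ , K-conn) =
    (w , x∈p∪q⁺ (inj₁ w∈H)) , λ u v u∈ v∈ → to-w u∈ ◅◅ adjacents-sym {H ⊔ K} (to-w v∈)
    where
    to-w : ∀ {u} → u ∈ verts (H ⊔ K) → Star (Adjacent (H ⊔ K)) u w
    to-w u∈ with x∈p∪q⁻ (verts H) (verts K) u∈
    ... | inj₁ u∈H = adjacent-⊑ {H} {H ⊔ K} (x∈p∪q⁺ ∘ inj₁) (H-conn _ _ u∈H w∈H)
    ... | inj₂ u∈K = adjacent-⊑ {K} {H ⊔ K} (x∈p∪q⁺ ∘ inj₂) (K-conn _ _ u∈K w∈K)

  ⊔-lub : ∀ {H K M : Piece G} → H ⊑ M → K ⊑ M → H ⊔ K ⊑ M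
  ⊔-lub {H} {K} (Hv , He) (Kv , Ke) =
    (λ x∈ → [ Hv , Kv ]′ (x∈p∪q⁻ (verts H) (verts K) x∈)) , λ x∈ → [ He , Ke ]′ (x∈p∪q⁻ (edges H) (edges K) x∈)

  -- The shared vertex `w` keeps the union connected, so maximality of `D` applies to it.
  component-absorbs : ∀ {M D K w} → IsComponent M D → IsSubgraph K → K ⊑ M → Connected K →
    w ∈ verts D → w ∈ verts K → D ⊔ K ≡ D
  component-absorbs {M} {D} {K} (D-sub , D⊑M , D-conn , maximal) K-sub K⊑M K-conn w∈D w∈K =
    maximal (D ⊔ K) (⊔-isSubgraph {D} {K} D-sub K-sub) (⊔-lub {D} {K} {M} D⊑M K⊑M)
      (⊔-connected {D} {K} w∈D w∈K D-conn K-conn) ((x∈p∪q⁺ ∘ inj₁) , (x∈p∪q⁺ ∘ inj₁))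

  components-equal : ∀ {M D D′ w} → IsComponent M D → IsComponent M D′ → w ∈ verts D → w ∈ verts D′ → D ≡ D′
  components-equal {M} {D} {D′} Dc@(D-sub , D⊑M , D-conn , _) D′c@(D′-sub , D′⊑M , D′-conn , _) w∈D w∈D′ =
    trans (sym (component-absorbs {M} {D} {D′} Dc D′-sub D′⊑M D′-conn w∈D w∈D′))
      (trans (cong₂ piece (∪-comm (verts D) (verts D′)) (∪-comm (edges D) (edges D′)))
        (component-absorbs {M} {D′} {D} D′c D-sub D⊑M D-conn w∈D′ w∈D))

  joined-piece : E → Piece G
  joined-piece h = piece (⁅ end₁ G h ⁆ ∪ ⁅ end₂ G h ⁆) ⁅ h ⁆

  ∈-joined⁺ : ∀ {h w} → Incident h w → w ∈ verts (joined-piece h)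
  ∈-joined⁺ (inj₁ refl) = x∈p∪q⁺ (inj₁ (x∈⁅x⁆ _))
  ∈-joined⁺ (inj₂ refl) = x∈p∪q⁺ (inj₂ (x∈⁅x⁆ _))

  ∈-joined⁻ : ∀ {h w} → w ∈ verts (joined-piece h) → Incident h w
  ∈-joined⁻ w∈ = Sum.map (sym ∘ x∈⁅y⁆⇒x≡y _) (sym ∘ x∈⁅y⁆⇒x≡y _) (x∈p∪q⁻ _ _ w∈)

  joined-isSubgraph : ∀ h → IsSubgraph (joined-piece h)
  joined-isSubgraph h g g∈ with x∈⁅y⁆⇒x≡y h g∈
  ... | refl = ∈-joined⁺ (inj₁ refl) , ∈-joined⁺ (inj₂ refl)

  joined-connected : ∀ h → Connected (joined-piece h)
  joined-connected h = (_ , ∈-joined⁺ (inj₁ refl)) , λ u v u∈ v∈ → link (∈-joined⁻ u∈) (∈-joined⁻ v∈)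
    where
    link : ∀ {u v} → Incident h u → Incident h v → Star (Adjacent (joined-piece h)) u v
    link {u} {v} i i′ with u ≟ v
    ... | yes refl = ε
    ... | no u≢v   = (h , x∈⁅x⁆ h , incident-both i i′ u≢v) ◅ ε

  bridgeOf : Piece G → Piece G
  bridgeOf D = piece (verts D) (edges D ∪ edgesBetween G (verts D) (verts C))

  module _ {D : Piece G} (D-comp : IsComponent (delete G (verts C)) D) where

    component-off : ∀ {w} → w ∈ verts D → ¬ On w
    component-off w∈ = x∈∁p⇒x∉p (proj₁ (proj₁ (proj₂ D-comp)) w∈)

    -- If the other end is on `C`, then `h` is an attaching edge. Otherwise `h` with its ends is a
    -- connected subgraph off `C`, which the component absorbs.
    component-edge : ∀ {h w} → w ∈ verts D → Incident h w → h ∈ edges (bridgeOf D)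
    component-edge {h} {w} w∈ i with incident-joins i
    ... | y , j with y ∈? verts C
    ...   | yes on = x∈p∪q⁺ (inj₂ (∈-edgesBetween⁺ G _ _ j w∈ on))
    ...   | no off = x∈p∪q⁺ (inj₁ (subst (λ K → h ∈ edges K)
        (component-absorbs {delete G (verts C)} {D} {joined-piece h} D-comp
          (joined-isSubgraph h) (vs⊑ , es⊑) (joined-connected h) w∈ (∈-joined⁺ i))
        (x∈p∪q⁺ (inj₂ (x∈⁅x⁆ h)))))
      where
      end-off : ∀ {x} → Incident h x → ¬ On x
      end-off ix with incident-end j ix
      ... | inj₁ refl = component-off w∈
      ... | inj₂ refl = off
      vs⊑ : verts (joined-piece h) ⊆ ∁ (verts C)
      vs⊑ x∈ = x∉p⇒x∈∁p (end-off (∈-joined⁻ x∈))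
      es⊑ : ⁅ h ⁆ ⊆ edges (delete G (verts C))
      es⊑ g∈ with x∈⁅y⁆⇒x≡y h g∈
      ... | refl = ∈-delete⁺ G (verts C) (end-off (inj₁ refl)) (end-off (inj₂ refl))

    bridge-edge-end : ∀ {h w} → h ∈ edges (bridgeOf D) → Incident h w → ¬ On w → w ∈ verts D
    bridge-edge-end h∈ i off with x∈p∪q⁻ (edges D) _ h∈
    ... | inj₁ h∈D = subgraph-incident {D} (proj₁ D-comp) h∈D i
    ... | inj₂ h∈between with ∈-edgesBetween⁻ G (verts D) (verts C) h∈between | i
    ...   | inj₁ (p , _) | inj₁ refl = p
    ...   | inj₁ (_ , q) | inj₂ refl = ⊥-elim (off q)
    ...   | inj₂ (p , _) | inj₁ refl = ⊥-elim (off p)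
    ...   | inj₂ (_ , q) | inj₂ refl = q

    bridge-edge-inner : ∀ {h} → h ∈ edges (bridgeOf D) → ∃ λ w → Incident h w × w ∈ verts D
    bridge-edge-inner h∈ with x∈p∪q⁻ (edges D) _ h∈
    ... | inj₁ h∈D = _ , inj₁ refl , proj₁ (proj₁ D-comp _ h∈D)
    ... | inj₂ h∈between with ∈-edgesBetween⁻ G (verts D) (verts C) h∈between
    ...   | inj₁ (p , _) = _ , inj₁ refl , p
    ...   | inj₂ (_ , q) = _ , inj₂ refl , q

  chord-on : ∀ {f w} → IsChord C f → Incident f w → On w
  chord-on (_ , p , _ , _) (inj₁ refl) = p
  chord-on (_ , _ , q , _) (inj₂ refl) = q

  -- A linking vertex is off `C`. A chord has no such end; in the other kind of bridge the vertex
  -- belongs to the component, all of whose incident edges are in the bridge.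
  bridge-linked : ∀ {b h h′} → IsBridge C b → Star (Linked On) h h′ → h ∈ edges b → h′ ∈ edges b
  bridge-linked br ε h∈ = h∈
  bridge-linked br@(chord f f-chord) ((w , off , i , _) ◅ _) h∈ with x∈⁅y⁆⇒x≡y f h∈
  ... | refl = ⊥-elim (off (chord-on f-chord i))
  bridge-linked br@(component D D-comp) ((w , off , i , i′) ◅ rest) h∈ =
    bridge-linked br rest (component-edge D-comp (bridge-edge-end D-comp h∈ i off) i′)

  -- An edge of a component bridge has an end in the component, hence off `C`. This rules out chords
  -- and forces two components to share a vertex.
  bridges-equal : ∀ {b b′ h} → IsBridge C b → IsBridge C b′ → h ∈ edges b → h ∈ edges b′ → b ≡ b′
  bridges-equal (chord f _) (chord f′ _) h∈ h∈′ =
    cong (λ g → piece ⊥ ⁅ g ⁆) (trans (sym (x∈⁅y⁆⇒x≡y f h∈)) (x∈⁅y⁆⇒x≡y f′ h∈′))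
  bridges-equal (chord f f-chord) (component D D-comp) h∈ h∈′ with x∈⁅y⁆⇒x≡y f h∈ | bridge-edge-inner D-comp h∈′
  ... | refl | w , i , w∈ = ⊥-elim (component-off D-comp w∈ (chord-on f-chord i))
  bridges-equal (component D D-comp) (chord f f-chord) h∈ h∈′ with x∈⁅y⁆⇒x≡y f h∈′ | bridge-edge-inner D-comp h∈
  ... | refl | w , i , w∈ = ⊥-elim (component-off D-comp w∈ (chord-on f-chord i))
  bridges-equal (component D D-comp) (component D′ D′-comp) h∈ h∈′ with bridge-edge-inner D-comp h∈
  ... | w , i , w∈ = cong bridgeOf (components-equal {delete G (verts C)} {D} {D′} D-comp D′-comp w∈
          (bridge-edge-end D′-comp h∈′ i (component-off D-comp w∈)))

  -- A component may be a single vertex without edges; an edge then has to come from its connection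
  -- to `C`.
  bridge-nonempty : Connected (whole G) → Nonempty (verts C) → ∀ {b} → IsBridge C b →
    ∃ λ h → h ∈ edges b × h ∉ edges C
  bridge-nonempty _ _ (chord f f-chord) = f , x∈⁅x⁆ f , proj₁ f-chord
  bridge-nonempty (_ , conn) (c , c∈) (component D D-comp@(_ , _ , ((w , w∈) , _) , _)) with conn w c ∈⊤ ∈⊤
  ... | ε = ⊥-elim (component-off D-comp w∈ c∈)
  ... | (h , _ , j) ◅ _ = h , component-edge D-comp w∈ (joins-incidentˡ j) ,
    λ h∈C → component-off D-comp w∈ (subgraph-incident {C} C-sub h∈C (joins-incidentˡ j))

-- A loop and all other edges would separate at the vertex of the loop. Two distinct edges ensure
-- that some edge other than the loop exists.
nonseparable⇒loopless : (G : Graph) → IsNonseparable (whole G) → ∀ {e f : Fin (size G)} → e ≢ f →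
  ∀ h → end₁ G h ≢ end₂ G h
nonseparable⇒loopless G (_ , _ , no-cutpoint) {e} {f} e≢f h loop = no-cutpoint
  (end₁ G h , piece ⁅ end₁ G h ⁆ ⁅ h ⁆ , piece ⊤ (∁ ⁅ h ⁆)
  , (λ g g∈ → K-sub g (x∈⁅y⁆⇒x≡y h g∈)) , (λ _ _ → ∈⊤ , ∈⊤)
  , (h , x∈⁅x⁆ h) , other
  , ⊆-antisym (λ _ → ∈⊤) (λ _ → x∈p∪q⁺ (inj₂ ∈⊤)) , p∪∁p≡⊤ ⁅ h ⁆
  , ⊆-antisym (λ x∈ → proj₁ (x∈p∩q⁻ _ _ x∈)) (λ x∈ → x∈p∩q⁺ (x∈ , ∈⊤))
  , ⊆-antisym (λ x∈ → let p , q = x∈p∩q⁻ _ _ x∈ in ⊥-elim (x∈∁p⇒x∉p q p)) (⊥-elim ∘ ∉⊥))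
  where
  K-sub : ∀ g → g ≡ h → end₁ G g ∈ ⁅ end₁ G h ⁆ × end₂ G g ∈ ⁅ end₁ G h ⁆
  K-sub g refl = x∈⁅x⁆ _ , subst (_∈ ⁅ end₁ G h ⁆) loop (x∈⁅x⁆ _)
  other : Nonempty (∁ ⁅ h ⁆)
  other with e ≟ h
  ... | no e≢h   = e , x∉p⇒x∈∁p (x≢y⇒x∉⁅y⁆ e≢h)
  ... | yes refl = f , x∉p⇒x∈∁p (x≢y⇒x∉⁅y⁆ (e≢f ∘ sym))

-- Two different positive circles through `f`.

mainTheorem6 : (S : SignedGraph) →
    IsBlock (whole (graph S)) →
    ¬ IsSingleEdge (whole (graph S)) →
    ¬ IsCircle (whole (graph S)) →
    (e : Fin (size (graph S))) (C : Piece (graph S)) →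
    OnlyPositiveCircle S e C →
    HasAtLeastBridges 3 C →
    (f : Fin (size (graph S))) → f ∉ edges C →
    ¬ IsPositiveBattery S f
mainTheorem6 S (nonsep , _) _ _ e C ((C-circle , C-positive) , e∈ , only-C) (b , b-inj , bridge) f f∉
  (C′ , _ , _ , only-C′) =
  -- Two tests suffice: if `f` is linked to one representative edge, it is not linked to the other
  -- two; if it is linked to neither of the first two, these serve.
  ¬¬-excluded-middle {A = Star (Linked On) f (g zero)} λ
    { (yes f~0) → conflict (suc zero) (suc (suc zero)) (λ ()) (far-from-others f~0 λ ()) (far-from-others f~0 λ ())
    ; (no f≁0) → ¬¬-excluded-middle {A = Star (Linked On) f (g (suc zero))} λ
        { (yes f~1) → conflict zero (suc (suc zero)) (λ ()) f≁0 (far-from-others f~1 λ ())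
        ; (no f≁1)  → conflict zero (suc zero) (λ ()) f≁0 f≁1 } }
  where
  G = graph S
  C-sub = proj₁ C-circle
  loopless = nonseparable⇒loopless G nonsep {e} {f} λ { refl → f∉ e∈ }
  open Walks G
  open Linkage G
  open Bridges G C C-sub
  open Ears G loopless C C-sub
  open Batteries S loopless C C-circle C-positive e∈ only-C

  bridge-edge : ∀ i → ∃ λ h → h ∈ edges (b i) × h ∉ edges C
  bridge-edge i = bridge-nonempty (proj₁ (proj₂ nonsep)) (proj₁ (proj₁ (proj₂ C-circle))) (bridge i)

  g : Fin 3 → E
  g = proj₁ ∘ bridge-edge

  -- Linked edges stay in one bridge, an edge determines its bridge, and `b` is injective.
  separate : ∀ {i j} → i ≢ j → ¬ Star (Linked On) (g i) (g j)
  separate {i} {j} i≢j i~j = i≢j (b-inj (bridges-equal (bridge i) (bridge j)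
    (bridge-linked (bridge i) i~j (proj₁ (proj₂ (bridge-edge i)))) (proj₁ (proj₂ (bridge-edge j)))))

  far-from-others : ∀ {i j} → Star (Linked On) f (g i) → i ≢ j → ¬ Star (Linked On) f (g j)
  far-from-others f~i i≢j f~j = separate i≢j (linked-sym f~i ◅◅ f~j)

  on-ear : ∀ {h} → h ∉ edges C → ¬ ¬ (∃₂ λ a b → ∃ λ (P : Ear a b) → h ∈ᵉ path P)
  on-ear = edge-on-ear nonsep e∈

  -- A common edge, or a common vertex off `C`, would link `h` to `k` along the two ears.
  join-separate : ∀ {a b c d h k} (P : Ear a b) (Q : Ear c d) → h ∈ᵉ path P → k ∈ᵉ path Q →
    ¬ Star (Linked On) h k → JoinedEars P Q
  join-separate P Q h∈ k∈ h≁k = join-ears P Q meet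
    λ x∈P x∈Q → h≁k (ear-linked P h∈ x∈P ◅◅ ear-linked Q x∈Q k∈)
    where
    meet : Meet (path P) (path Q) On
    meet {z} z∈P z∈Q = decidable-stable (z ∈? verts C) λ off →
      let x , x∈ , ix = vertex-edge (path P) (ends≢ P) z∈P
          y , y∈ , iy = vertex-edge (path Q) (ends≢ Q) z∈Q
      in h≁k (ear-linked P h∈ x∈ ◅◅ ((z , off , ix , iy) ◅ ear-linked Q y∈ k∈))

  -- Joining the ear through `f` to ears through `g i` and `g j` gives two positive circles through
  -- `f`. If both were `C′`, then `g j` would be on the ear of `f`, on the ear of `g i` or on `C`,
  -- and each of these is excluded.
  conflict : ∀ i j → i ≢ j → ¬ Star (Linked On) f (g i) → ¬ ¬ Star (Linked On) f (g j)
  conflict i j i≢j f≁i f≁j =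
    on-ear f∉ λ (_ , _ , P , f∈P) →
    on-ear (proj₂ (proj₂ (bridge-edge i))) λ (_ , _ , Q , i∈Q) →
    on-ear (proj₂ (proj₂ (bridge-edge j))) λ (_ , _ , R , j∈R) →
    let
      module PQ = JoinedEars (join-separate P Q f∈P i∈Q f≁i)
      module PR = JoinedEars (join-separate P R f∈P j∈R f≁j)
      same : PR.circle ≡ PQ.circle
      same = trans (only-C′ PR.circle PR.positive (PR.left⊆ f∈P))
                   (sym (only-C′ PQ.circle PQ.positive (PQ.left⊆ f∈P)))
    in case-union P Q f∈P i∈Q f≁j (PQ.⊆union (subst (λ Z → g j ∈ edges Z) same (PR.right⊆ j∈R)))
    where
    case-union : ∀ {a b c d} (P : Ear a b) (Q : Ear c d) → f ∈ᵉ path P → g i ∈ᵉ path Q →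
      ¬ Star (Linked On) f (g j) → ¬ (g j ∈ᵉ path P ⊎ g j ∈ᵉ path Q ⊎ g j ∈ edges C)
    case-union P Q f∈P i∈Q f≁j (inj₁ j∈P)        = f≁j (ear-linked P f∈P j∈P)
    case-union P Q f∈P i∈Q f≁j (inj₂ (inj₁ j∈Q)) = separate i≢j (ear-linked Q i∈Q j∈Q)
    case-union P Q f∈P i∈Q f≁j (inj₂ (inj₂ j∈C)) = proj₂ (proj₂ (bridge-edge j)) j∈C
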